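{- Let $\mathcal{A}$ be a cocomplete category and let $(\mathcal{V},\otimes,I)$ be a small monoidal category acting on $\mathcal{A}$ via $\triangleleft\colon \mathcal{V}\times\mathcal{A}\to\mathcal{A}$. Let $J_I\in\mathcal{A}$ be an object such that the functor $J\colon\mathcal{V}\to\mathcal{A}$ defined by $JV = V\triangleleft J_I$ is well-behaved for the functor $(-)\triangleleft A\colon \mathcal{V}\to\mathcal{A}$, for every $A\in\mathcal{A}$. Then every natural isomorphism $$\mathbf{a}\colon (V\triangleleft A)\triangleleft_J B\;\cong\; V\triangleleft (A\triangleleft_J B)\qquad (V\in\mathcal{V},\ A,B\in\mathcal{A})$$ induces natural isomorphisms $$\alpha\colon (A\triangleleft_J B)\triangleleft_J C\cong A\triangleleft_J(B\triangleleft_J C),\qquad \lambda\colon JI\triangleleft_J A\cong A,\qquad \rho\colon A\triangleleft_J JI\cong A,\qquad \gamma\colon JV\triangleleft_J A\cong V\triangleleft A$$ for $A,B,C\in\mathcal{A}$ and $V\in\mathcal{V}$.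
   Context: A (left) action of a monoidal category $(\mathcal{V},\otimes,I)$ on a category $\mathcal{A}$ is a functor $\triangleleft\colon\mathcal{V}\times\mathcal{A}\to\mathcal{A}$ with natural isomorphisms $I\triangleleft A\cong A$ and $V\triangleleft(U\triangleleft A)\cong(V\otimes U)\triangleleft A$ satisfying coherence conditions analogous to those of monoidal categories. For a set $S$ and an object $A$ of a cocomplete category, $S\cdot A$ denotes the copower $\coprod_{s\in S}A$. Given a functor $J\colon\mathcal{V}\to\mathcal{A}$ from a small category to a cocomplete category, the $J$-extension of a bifunctor $F\colon\mathcal{V}\times\mathcal{A}\to\mathcal{A}$ is the bifunctor $F_J=\mathrm{Lan}_{J\times 1}F\colon\mathcal{A}\times\mathcal{A}\to\mathcal{A}$, $F_J(A,B)=\int^{V\in\mathcal{V}}\mathcal{A}(JV,A)\cdot F(V,B)$. In particular $A\triangleleft_J B=\int^{V\in\mathcal{V}}\mathcal{A}(JV,A)\cdot(V\triangleleft B)$. A functor $J\colon\mathcal{V}\to\mathcal{A}$ is well-behaved for a functor $F\colon\mathcal{V}\to\mathcal{A}$ if $J$ is fully faithful, $J$ is dense (i.e. the nerve functor $\nu_J\colon\mathcal{A}\to[\mathcal{V}^{\mathrm{op}},\mathbf{Set}]$, $\nu_J A=\mathcal{A}(J(-),A)$, is fully faithful), and the nerve of $J$ preserves the left Kan extension $\mathrm{Lan}_J F$, that is, $\mathrm{Lan}_J(\mathcal{A}(JV,F-))A\cong\mathcal{A}(JV,(\mathrm{Lan}_JF)A)$ for all $V\in\mathcal{V}$, $A\in\mathcal{A}$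 (via the canonical comparison). Here $(\mathrm{Lan}_JF)A=\int^{V}\mathcal{A}(JV,A)\cdot FV$. -}

module Defs where

open import Level using (Level; _⊔_; suc)
open import Data.Unit.Polymorphic using (⊤)
open import Data.Product using (Σ; _×_; _,_; proj₁; proj₂)
open import Function.Bundles using (Func)
open import Function.Definitions using (Bijective)
open import Relation.Binary using (Setoid; IsEquivalence)
import Relation.Binary.Construct.Closure.Equivalence as EqC
open import Relation.Binary.Construct.Closure.ReflexiveTransitive using (ε; _◅_)
open import Relation.Binary.Construct.Closure.Symmetric using (fwd; bwd)
import Relation.Binary.Reasoning.Setoid as SetoidReasoning

private
  variable
    o o₁ o₂ o₃ ℓ ℓ₁ ℓ₂ ℓ₃ : Level

-- Sets are represented by setoids, so hom-sets are setoids.  `Category o ℓ`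
-- is locally ℓ-small; it is ℓ-small when o = ℓ.
--
-- The INLINE pragmas make Agda treat definitions by record expressions as
-- copattern definitions, so that categories and functors do not unfold
-- during unification.

record Category (o ℓ : Level) : Set (suc (o ⊔ ℓ)) where
  no-eta-equality
  constructor mkCategory
  infixr 9 _∘_
  infix  4 _≈_ _⇒_
  field
    Obj       : Set o
    _⇒_       : Obj → Obj → Set ℓ
    _≈_       : ∀ {X Y} → X ⇒ Y → X ⇒ Y → Set ℓ
    id        : ∀ {X} → X ⇒ X
    _∘_       : ∀ {X Y Z} → Y ⇒ Z → X ⇒ Y → X ⇒ Z
    equiv     : ∀ {X Y} → IsEquivalence (_≈_ {X} {Y})
    assoc     : ∀ {W X Y Z} {f : W ⇒ X} {g : X ⇒ Y} {h : Y ⇒ Z} →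
                (h ∘ g) ∘ f ≈ h ∘ (g ∘ f)
    identityˡ : ∀ {X Y} {f : X ⇒ Y} → id ∘ f ≈ f
    identityʳ : ∀ {X Y} {f : X ⇒ Y} → f ∘ id ≈ f
    ∘-resp-≈  : ∀ {X Y Z} {f h : Y ⇒ Z} {g i : X ⇒ Y} →
                f ≈ h → g ≈ i → f ∘ g ≈ h ∘ i

  module Equiv {X Y} = IsEquivalence (equiv {X} {Y})

  hom-setoid : Obj → Obj → Setoid ℓ ℓ
  hom-setoid X Y = record { Carrier = X ⇒ Y ; _≈_ = _≈_ ; isEquivalence = equiv }

  module HomReasoning {X Y} = SetoidReasoning (hom-setoid X Y)

  ∘-resp-≈ˡ : ∀ {X Y Z} {f h : Y ⇒ Z} {g : X ⇒ Y} → f ≈ h → f ∘ g ≈ h ∘ g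
  ∘-resp-≈ˡ p = ∘-resp-≈ p Equiv.refl

  ∘-resp-≈ʳ : ∀ {X Y Z} {f : Y ⇒ Z} {g i : X ⇒ Y} → g ≈ i → f ∘ g ≈ f ∘ i
  ∘-resp-≈ʳ p = ∘-resp-≈ Equiv.refl p

  record IsIso {X Y : Obj} (f : X ⇒ Y) : Set ℓ where
    no-eta-equality
    field
      inv  : Y ⇒ X
      isoˡ : inv ∘ f ≈ id
      isoʳ : f ∘ inv ≈ id

{-# INLINE mkCategory #-}

infix 10 _[_,_] _[_≈_] _[_∘_]

_[_,_] : (C : Category o ℓ) → Category.Obj C → Category.Obj C → Set ℓ
C [ X , Y ] = Category._⇒_ C X Y

_[_≈_] : (C : Category o ℓ) {X Y : Category.Obj C} → C [ X , Y ] → C [ X , Y ] → Set ℓ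
C [ f ≈ g ] = Category._≈_ C f g

_[_∘_] : (C : Category o ℓ) {X Y Z : Category.Obj C} →
         C [ Y , Z ] → C [ X , Y ] → C [ X , Z ]
C [ g ∘ f ] = Category._∘_ C g f

op : Category o ℓ → Category o ℓ
op C = record
  { Obj       = Obj
  ; _⇒_       = λ X Y → Y ⇒ X
  ; _≈_       = _≈_
  ; id        = id
  ; _∘_       = λ f g → g ∘ f
  ; equiv     = equiv
  ; assoc     = Equiv.sym assoc
  ; identityˡ = identityʳ
  ; identityʳ = identityˡ
  ; ∘-resp-≈  = λ p q → ∘-resp-≈ q p
  }
  where open Category C

infixr 2 _⊠_

_⊠_ : Category o₁ ℓ₁ → Category o₂ ℓ₂ → Category (o₁ ⊔ o₂) (ℓ₁ ⊔ ℓ₂)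
C ⊠ D = record
  { Obj       = C.Obj × D.Obj
  ; _⇒_       = λ (X , Y) (X′ , Y′) → (X C.⇒ X′) × (Y D.⇒ Y′)
  ; _≈_       = λ (f , g) (f′ , g′) → (f C.≈ f′) × (g D.≈ g′)
  ; id        = C.id , D.id
  ; _∘_       = λ (f , g) (f′ , g′) → f C.∘ f′ , g D.∘ g′
  ; equiv     = record
    { refl  = C.Equiv.refl , D.Equiv.refl
    ; sym   = λ (p , q) → C.Equiv.sym p , D.Equiv.sym q
    ; trans = λ (p , q) (p′ , q′) → C.Equiv.trans p p′ , D.Equiv.trans q q′
    }
  ; assoc     = C.assoc , D.assoc
  ; identityˡ = C.identityˡ , D.identityˡ
  ; identityʳ = C.identityʳ , D.identityʳ
  ; ∘-resp-≈  = λ (p , q) (p′ , q′) → C.∘-resp-≈ p p′ , D.∘-resp-≈ q q′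
  }
  where
  module C = Category C
  module D = Category D

Setoids : ∀ ℓ → Category (suc ℓ) ℓ
Setoids ℓ = record
  { Obj       = Setoid ℓ ℓ
  ; _⇒_       = Func
  ; _≈_       = λ {S} {T} f g → ∀ x → Setoid._≈_ T (Func.to f x) (Func.to g x)
  ; id        = record { to = λ x → x ; cong = λ p → p }
  ; _∘_       = λ g f → record
    { to   = λ x → Func.to g (Func.to f x)
    ; cong = λ p → Func.cong g (Func.cong f p)
    }
  ; equiv     = λ {S} {T} → record
    { refl  = λ x → Setoid.refl T
    ; sym   = λ p x → Setoid.sym T (p x)
    ; trans = λ p q x → Setoid.trans T (p x) (q x)
    }
  ; assoc     = λ {W} {X} {Y} {Z} x → Setoid.refl Z
  ; identityˡ = λ {X} {Y} x → Setoid.refl Y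
  ; identityʳ = λ {X} {Y} x → Setoid.refl Y
  ; ∘-resp-≈  = λ {X} {Y} {Z} {f} {h} {g} {i} p q x →
                Setoid.trans Z (Func.cong f (q x)) (p (Func.to i x))
  }

record Functor (C : Category o₁ ℓ₁) (D : Category o₂ ℓ₂) :
               Set (o₁ ⊔ ℓ₁ ⊔ o₂ ⊔ ℓ₂) where
  no-eta-equality
  constructor mkFunctor
  private
    module C = Category C
    module D = Category D
  field
    F₀           : C.Obj → D.Obj
    F₁           : ∀ {X Y} → X C.⇒ Y → F₀ X D.⇒ F₀ Y
    identity     : ∀ {X} → F₁ (C.id {X}) D.≈ D.id
    homomorphism : ∀ {X Y Z} {f : X C.⇒ Y} {g : Y C.⇒ Z} →
                   F₁ (g C.∘ f) D.≈ F₁ g D.∘ F₁ f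
    F-resp-≈     : ∀ {X Y} {f g : X C.⇒ Y} → f C.≈ g → F₁ f D.≈ F₁ g

{-# INLINE mkFunctor #-}

idF : {C : Category o ℓ} → Functor C C
idF {C = C} = record
  { F₀ = λ X → X ; F₁ = λ f → f
  ; identity = Equiv.refl ; homomorphism = Equiv.refl ; F-resp-≈ = λ p → p
  }
  where open Category C

constF : {C : Category o₁ ℓ₁} {D : Category o₂ ℓ₂} → Category.Obj D → Functor C D
constF {D = D} X = record
  { F₀ = λ _ → X ; F₁ = λ _ → id
  ; identity = Equiv.refl ; homomorphism = Equiv.sym identityˡ
  ; F-resp-≈ = λ _ → Equiv.refl
  }
  where open Category D

infixr 9 _∘F_

_∘F_ : {C : Category o₁ ℓ₁} {D : Category o₂ ℓ₂} {E : Category o₃ ℓ₃} →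
       Functor D E → Functor C D → Functor C E
_∘F_ {E = E} G F = record
  { F₀ = λ X → G.F₀ (F.F₀ X)
  ; F₁ = λ f → G.F₁ (F.F₁ f)
  ; identity     = Equiv.trans (G.F-resp-≈ F.identity) G.identity
  ; homomorphism = Equiv.trans (G.F-resp-≈ F.homomorphism) G.homomorphism
  ; F-resp-≈     = λ p → G.F-resp-≈ (F.F-resp-≈ p)
  }
  where
  open Category E
  module F = Functor F
  module G = Functor G

opF : {C : Category o₁ ℓ₁} {D : Category o₂ ℓ₂} → Functor C D → Functor (op C) (op D)
opF F = record
  { F₀ = F₀ ; F₁ = F₁ ; identity = identity
  ; homomorphism = homomorphism ; F-resp-≈ = F-resp-≈
  }
  where open Functor F

π₁ : {C : Category o₁ ℓ₁} {D : Category o₂ ℓ₂} → Functor (C ⊠ D) C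
π₁ {C = C} = record
  { F₀ = proj₁ ; F₁ = proj₁
  ; identity = Equiv.refl ; homomorphism = Equiv.refl ; F-resp-≈ = proj₁
  }
  where open Category C

π₂ : {C : Category o₁ ℓ₁} {D : Category o₂ ℓ₂} → Functor (C ⊠ D) D
π₂ {D = D} = record
  { F₀ = proj₂ ; F₁ = proj₂
  ; identity = Equiv.refl ; homomorphism = Equiv.refl ; F-resp-≈ = proj₂
  }
  where open Category D

⟨_,_⟩ : {X : Category o₁ ℓ₁} {C : Category o₂ ℓ₂} {D : Category o₃ ℓ₃} →
        Functor X C → Functor X D → Functor X (C ⊠ D)
⟨ F , G ⟩ = record
  { F₀ = λ X → F.F₀ X , G.F₀ X
  ; F₁ = λ f → F.F₁ f , G.F₁ f
  ; identity     = F.identity , G.identity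
  ; homomorphism = F.homomorphism , G.homomorphism
  ; F-resp-≈     = λ p → F.F-resp-≈ p , G.F-resp-≈ p
  }
  where
  module F = Functor F
  module G = Functor G

-- F(–, B) for a bifunctor F.
_⟨–,_⟩ : {C : Category o₁ ℓ₁} {D : Category o₂ ℓ₂} {E : Category o₃ ℓ₃} →
         Functor (C ⊠ D) E → Category.Obj D → Functor C E
F ⟨–, B ⟩ = F ∘F ⟨ idF , constF B ⟩

record NaturalTransformation {C : Category o₁ ℓ₁} {D : Category o₂ ℓ₂}
                             (F G : Functor C D) : Set (o₁ ⊔ ℓ₁ ⊔ ℓ₂) where
  no-eta-equality
  constructor mkNT
  private
    module C = Category C
    module D = Category D
    module F = Functor F
    module G = Functor G
  field
    η       : ∀ X → F.F₀ X D.⇒ G.F₀ X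
    commute : ∀ {X Y} (f : X C.⇒ Y) → η Y D.∘ F.F₁ f D.≈ G.F₁ f D.∘ η X

{-# INLINE mkNT #-}

infix 4 _≅_

record _≅_ {C : Category o₁ ℓ₁} {D : Category o₂ ℓ₂}
           (F G : Functor C D) : Set (o₁ ⊔ ℓ₁ ⊔ ℓ₂) where
  no-eta-equality
  field
    to    : NaturalTransformation F G
    isIso : ∀ X → Category.IsIso D (NaturalTransformation.η to X)
  open NaturalTransformation to public

idN : {C : Category o₁ ℓ₁} {D : Category o₂ ℓ₂} {F : Functor C D} → NaturalTransformation F F
idN {D = D} = record
  { η = λ X → id ; commute = λ f → Equiv.trans identityˡ (Equiv.sym identityʳ) }
  where open Category D

infixr 9 _∘N_

_∘N_ : {C : Category o₁ ℓ₁} {D : Category o₂ ℓ₂} {F G H : Functor C D} →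
       NaturalTransformation G H → NaturalTransformation F G → NaturalTransformation F H
_∘N_ {D = D} {F} {G} {H} σ τ = record
  { η       = λ X → σ.η X ∘ τ.η X
  ; commute = λ {X} {Y} f → begin
      (σ.η Y ∘ τ.η Y) ∘ F.F₁ f  ≈⟨ assoc ⟩
      σ.η Y ∘ (τ.η Y ∘ F.F₁ f)  ≈⟨ ∘-resp-≈ʳ (τ.commute f) ⟩
      σ.η Y ∘ (G.F₁ f ∘ τ.η X)  ≈⟨ Equiv.sym assoc ⟩
      (σ.η Y ∘ G.F₁ f) ∘ τ.η X  ≈⟨ ∘-resp-≈ˡ (σ.commute f) ⟩
      (H.F₁ f ∘ σ.η X) ∘ τ.η X  ≈⟨ assoc ⟩
      H.F₁ f ∘ (σ.η X ∘ τ.η X)  ∎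
  }
  where
  open Category D
  open HomReasoning
  module F = Functor F
  module G = Functor G
  module H = Functor H
  module σ = NaturalTransformation σ
  module τ = NaturalTransformation τ

Functors : Category ℓ₁ ℓ₁ → Category o₂ ℓ₂ → Category (ℓ₁ ⊔ o₂ ⊔ ℓ₂) (ℓ₁ ⊔ ℓ₂)
Functors {ℓ₁ = ℓ₁} {ℓ₂ = ℓ₂} C D = record
  { Obj       = Functor C D
  ; _⇒_       = NaturalTransformation
  ; _≈_       = λ σ τ → ∀ X → η σ X ≈ η τ X
  ; id        = idN
  ; _∘_       = _∘N_
  ; equiv     = record
    { refl  = λ X → Equiv.refl
    ; sym   = λ p X → Equiv.sym (p X)
    ; trans = λ p q X → Equiv.trans (p X) (q X)
    }
  ; assoc     = λ X → assoc
  ; identityˡ = λ X → identityˡ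
  ; identityʳ = λ X → identityʳ
  ; ∘-resp-≈  = λ p q X → ∘-resp-≈ (p X) (q X)
  }
  where
  open Category D
  open NaturalTransformation

-- F ↦ (B ↦ F(–, B)).
curryF : {C : Category ℓ₁ ℓ₁} {D : Category o₂ ℓ₂} {E : Category o₃ ℓ₃} →
         Functor (C ⊠ D) E → Functor D (Functors C E)
curryF {C = C} {D = D} {E = E} F = record
  { F₀ = λ B → F ⟨–, B ⟩
  ; F₁ = λ g → record
    { η       = λ X → F₁ (C.id , g)
    ; commute = λ f → Equiv.trans (Equiv.sym homomorphism)
        (Equiv.trans (F-resp-≈ ( C.Equiv.trans C.identityˡ (C.Equiv.sym C.identityʳ)
                               , D.Equiv.trans D.identityʳ (D.Equiv.sym D.identityˡ)))
                     homomorphism)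
    }
  ; identity     = λ X → identity
  ; homomorphism = λ X →
      Equiv.trans (F-resp-≈ (C.Equiv.sym C.identityˡ , D.Equiv.refl)) homomorphism
  ; F-resp-≈     = λ p → λ X → F-resp-≈ (C.Equiv.refl , p)
  }
  where
  module C = Category C
  module D = Category D
  open Category E
  open Functor F

FullyFaithful : {C : Category o₁ ℓ₁} {D : Category o₂ ℓ₂} → Functor C D → Set (o₁ ⊔ ℓ₁ ⊔ ℓ₂)
FullyFaithful {C = C} {D = D} F =
  ∀ X Y → Bijective (Category._≈_ C {X} {Y}) (Category._≈_ D) (Functor.F₁ F)

Hom[_] : (C : Category o ℓ) → Functor (op C ⊠ C) (Setoids ℓ)
Hom[ C ] = record
  { F₀ = λ (X , Y) → hom-setoid X Y
  ; F₁ = λ (f , g) → record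
    { to   = λ h → g ∘ h ∘ f
    ; cong = λ p → ∘-resp-≈ʳ (∘-resp-≈ˡ p)
    }
  ; identity     = λ h → Equiv.trans identityˡ identityʳ
  ; homomorphism = λ {_} {_} {_} {(f , g)} {(f′ , g′)} h → begin
      (g′ ∘ g) ∘ h ∘ f ∘ f′    ≈⟨ assoc ⟩
      g′ ∘ g ∘ h ∘ f ∘ f′      ≈⟨ ∘-resp-≈ʳ (∘-resp-≈ʳ (Equiv.sym assoc)) ⟩
      g′ ∘ g ∘ (h ∘ f) ∘ f′    ≈⟨ ∘-resp-≈ʳ (Equiv.sym assoc) ⟩
      g′ ∘ (g ∘ h ∘ f) ∘ f′    ∎
  ; F-resp-≈     = λ (p , q) h → ∘-resp-≈ q (∘-resp-≈ʳ p)
  }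
  where
  open Category C
  open HomReasoning

Hom[_][_,–] : (C : Category o ℓ) → Category.Obj C → Functor C (Setoids ℓ)
Hom[ C ][ X ,–] = Hom[ C ] ∘F ⟨ constF X , idF ⟩

-- 𝓐(J–, =), curried on the right: the nerve functor ν_J.
nerve : {V : Category ℓ ℓ} {A : Category o ℓ} →
        Functor V A → Functor A (Functors (op V) (Setoids ℓ))
nerve {A = A} J = curryF (Hom[ A ] ∘F ⟨ opF J ∘F π₁ , π₂ ⟩)

Dense : {V : Category ℓ ℓ} {A : Category o ℓ} → Functor V A → Set (o ⊔ ℓ)
Dense J = FullyFaithful (nerve J)

record Cocone {D : Category o₁ ℓ₁} {C : Category o₂ ℓ₂} (F : Functor D C) :
              Set (o₁ ⊔ ℓ₁ ⊔ o₂ ⊔ ℓ₂) where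
  no-eta-equality
  private module D = Category D
  open Category C
  open Functor F
  field
    apex : Obj
    ψ    : ∀ d → F₀ d ⇒ apex
    nat  : ∀ {d e} (u : d D.⇒ e) → ψ e ∘ F₁ u ≈ ψ d

record Colimit {D : Category o₁ ℓ₁} {C : Category o₂ ℓ₂} (F : Functor D C) :
               Set (o₁ ⊔ ℓ₁ ⊔ o₂ ⊔ ℓ₂) where
  no-eta-equality
  open Category C
  field
    cocone : Cocone F
  open Cocone cocone public
  field
    factor   : (K : Cocone F) → apex ⇒ Cocone.apex K
    commutes : (K : Cocone F) → ∀ d → factor K ∘ ψ d ≈ Cocone.ψ K d
    unique   : (K : Cocone F) (h : apex ⇒ Cocone.apex K) →
               (∀ d → h ∘ ψ d ≈ Cocone.ψ K d) → h ≈ factor K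

-- Cocompleteness is a choice of colimits of all ℓ-small diagrams.
Cocomplete : Category o ℓ → Set (o ⊔ suc ℓ)
Cocomplete {ℓ = ℓ} C = (D : Category ℓ ℓ) (F : Functor D C) → Colimit F

Setoids-cocomplete : Cocomplete (Setoids ℓ)
Setoids-cocomplete {ℓ} D F = record
  { cocone   = record
    { apex = EqC.setoid Step
    ; ψ    = λ d → record
      { to   = λ x → d , x
      ; cong = λ p → fwd (D.id , F₀.trans d (identity _) p) ◅ ε
      }
    ; nat  = λ {d} {e} u x → bwd (u , F₀.refl e) ◅ ε
    }
  ; factor   = factor
  ; commutes = λ K d x → Setoid.refl (Cocone.apex K)
  ; unique   = λ K h p (d , x) → p d x
  }
  where
  module D = Category D
  open Functor F
  module F₀ d = Setoid (F₀ d)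

  Step : Σ D.Obj F₀.Carrier → Σ D.Obj F₀.Carrier → Set ℓ
  Step (d , x) (e , y) = Σ (d D.⇒ e) λ u → F₀._≈_ e (Func.to (F₁ u) x) y

  factor : (K : Cocone F) → Func (EqC.setoid Step) (Cocone.apex K)
  factor K = record { to = to ; cong = EqC.gfold K.isEquivalence to step }
    where
    module K = Setoid (Cocone.apex K)
    to : Σ D.Obj F₀.Carrier → K.Carrier
    to (d , x) = Func.to (Cocone.ψ K d) x
    step : ∀ {p q} → Step p q → to p K.≈ to q
    step {d , x} {e , y} (u , r) =
      K.trans (K.sym (Cocone.nat K u x)) (Func.cong (Cocone.ψ K e) r)

-- The copower S · X is the coproduct of the family constant at X indexed by
-- the setoid S: the colimit of a constant diagram on S as a discrete category.
Discrete : Setoid ℓ ℓ → Category ℓ ℓ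
Discrete S = record
  { Obj = Carrier ; _⇒_ = _≈_ ; _≈_ = λ _ _ → ⊤
  ; id = refl ; _∘_ = λ p q → trans q p
  ; equiv = _ ; assoc = _ ; identityˡ = _ ; identityʳ = _ ; ∘-resp-≈ = _
  }
  where open Setoid S

module Copowers {E : Category o ℓ} (cocomplete : Cocomplete E) where
  open Category E

  private
    diagram : (S : Setoid ℓ ℓ) → Obj → Functor (Discrete S) E
    diagram S X = constF X

    opaque
      colim : (S : Setoid ℓ ℓ) (X : Obj) → Colimit (diagram S X)
      colim S X = cocomplete (Discrete S) (diagram S X)

  infixr 7 _·_

  _·_ : Setoid ℓ ℓ → Obj → Obj
  S · X = Colimit.apex (colim S X)

  ι : ∀ {S X} → Setoid.Carrier S → X ⇒ S · X
  ι {S} {X} = Colimit.ψ (colim S X)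

  ι-cong : ∀ {S X} {s t : Setoid.Carrier S} → Setoid._≈_ S s t → ι {S} {X} s ≈ ι t
  ι-cong {S} {X} p = Equiv.trans (Equiv.sym (Colimit.nat (colim S X) p)) identityʳ

  private
    toCocone : ∀ {S X Y} → Func S (hom-setoid X Y) → Cocone (diagram S X)
    toCocone {Y = Y} f = record
      { apex = Y ; ψ = Func.to f
      ; nat = λ p → Equiv.trans identityʳ (Equiv.sym (Func.cong f p)) }

  copair : ∀ {S X Y} → Func S (hom-setoid X Y) → S · X ⇒ Y
  copair {S} {X} f = Colimit.factor (colim S X) (toCocone f)

  copair-ι : ∀ {S X Y} (f : Func S (hom-setoid X Y)) (s : Setoid.Carrier S) →
             copair f ∘ ι s ≈ Func.to f s
  copair-ι {S} {X} f = Colimit.commutes (colim S X) (toCocone f)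

  copair-unique : ∀ {S X Y} (f : Func S (hom-setoid X Y)) (h : S · X ⇒ Y) →
                  (∀ s → h ∘ ι s ≈ Func.to f s) → h ≈ copair f
  copair-unique {S} {X} f = Colimit.unique (colim S X) (toCocone f)

  ·-ext : ∀ {S X Y} {h k : S · X ⇒ Y} → (∀ s → h ∘ ι s ≈ k ∘ ι s) → h ≈ k
  ·-ext {S} {X} {Y} {h} {k} p = Equiv.trans (copair-unique f h p)
      (Equiv.sym (copair-unique f k (λ s → Equiv.refl)))
    where
    f : Func S (hom-setoid X Y)
    f = record { to = λ s → k ∘ ι s ; cong = λ q → ∘-resp-≈ʳ (ι-cong q) }

  private
    injections : ∀ {S T : Setoid ℓ ℓ} {X Y} → Func S T → X ⇒ Y → Func S (hom-setoid X (T · Y))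
    injections u f = record
      { to   = λ s → ι (Func.to u s) ∘ f
      ; cong = λ p → ∘-resp-≈ˡ (ι-cong (Func.cong u p)) }

  infixr 7 _·₁_

  _·₁_ : ∀ {S T : Setoid ℓ ℓ} {X Y} → Func S T → X ⇒ Y → S · X ⇒ T · Y
  u ·₁ f = copair (injections u f)

  ·₁-ι : ∀ {S T : Setoid ℓ ℓ} {X Y} (u : Func S T) (f : X ⇒ Y) (s : Setoid.Carrier S) →
         (u ·₁ f) ∘ ι s ≈ ι (Func.to u s) ∘ f
  ·₁-ι u f = copair-ι (injections u f)

  copower : Functor (Setoids ℓ ⊠ E) E
  copower = record
    { F₀ = λ (S , X) → S · X
    ; F₁ = λ (u , f) → u ·₁ f
    ; identity     = ·-ext λ s →
        Equiv.trans (·₁-ι (Category.id (Setoids ℓ)) id s)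
          (Equiv.trans identityʳ (Equiv.sym identityˡ))
    ; homomorphism = λ {_} {_} {_} {(u , f)} {(v , g)} → ·-ext λ s → begin
        ((Setoids ℓ [ v ∘ u ]) ·₁ (g ∘ f)) ∘ ι s  ≈⟨ ·₁-ι (Setoids ℓ [ v ∘ u ]) (g ∘ f) s ⟩
        ι (Func.to v (Func.to u s)) ∘ g ∘ f   ≈⟨ Equiv.sym assoc ⟩
        (ι (Func.to v (Func.to u s)) ∘ g) ∘ f ≈⟨ ∘-resp-≈ˡ (Equiv.sym (·₁-ι v g _)) ⟩
        ((v ·₁ g) ∘ ι (Func.to u s)) ∘ f      ≈⟨ assoc ⟩
        (v ·₁ g) ∘ ι (Func.to u s) ∘ f        ≈⟨ ∘-resp-≈ʳ (Equiv.sym (·₁-ι u f s)) ⟩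
        (v ·₁ g) ∘ (u ·₁ f) ∘ ι s             ≈⟨ Equiv.sym assoc ⟩
        ((v ·₁ g) ∘ (u ·₁ f)) ∘ ι s           ∎
    ; F-resp-≈     = λ {_} {_} {(u , f)} {(v , g)} (p , q) → ·-ext λ s →
        Equiv.trans (·₁-ι u f s)
          (Equiv.trans (∘-resp-≈ (ι-cong (p s)) q) (Equiv.sym (·₁-ι v g s)))
    }
    where open HomReasoning

module _ {V : Category o₁ ℓ₁} {E : Category o₂ ℓ₂} (T : Functor (op V ⊠ V) E) where
  private module V = Category V
  open Category E
  open Functor T

  record Cowedge : Set (o₁ ⊔ ℓ₁ ⊔ o₂ ⊔ ℓ₂) where
    no-eta-equality
    field
      apex  : Obj
      ψ     : ∀ X → F₀ (X , X) ⇒ apex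
      dinat : ∀ {X Y} (f : X V.⇒ Y) → ψ Y ∘ F₁ (V.id , f) ≈ ψ X ∘ F₁ (f , V.id)

  record Coend : Set (o₁ ⊔ ℓ₁ ⊔ o₂ ⊔ ℓ₂) where
    no-eta-equality
    field
      cowedge : Cowedge
    open Cowedge cowedge public
    field
      factor   : (K : Cowedge) → apex ⇒ Cowedge.apex K
      commutes : (K : Cowedge) → ∀ X → factor K ∘ ψ X ≈ Cowedge.ψ K X
      unique   : (K : Cowedge) (h : apex ⇒ Cowedge.apex K) →
                 (∀ X → h ∘ ψ X ≈ Cowedge.ψ K X) → h ≈ factor K

    ext : ∀ {Y} {h k : apex ⇒ Y} → (∀ X → h ∘ ψ X ≈ k ∘ ψ X) → h ≈ k
    ext {Y} {h} {k} p =
      Equiv.trans (unique K h p) (Equiv.sym (unique K k (λ X → Equiv.refl)))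
      where
      K : Cowedge
      K = record
        { apex = Y
        ; ψ = λ X → k ∘ ψ X
        ; dinat = λ f → Equiv.trans assoc
            (Equiv.trans (∘-resp-≈ʳ (dinat f)) (Equiv.sym assoc))
        }

-- Objects are arrows f : X → Y; an arrow from f to g : X′ → Y′ is a
-- factorisation f = v ∘ g ∘ u.  A bifunctor T contravariant in its first
-- argument is covariant on this category via f ↦ T(Y, X), and its colimit
-- is the coend of T.
Factorisations : Category ℓ ℓ → Category ℓ ℓ
Factorisations {ℓ} V = record
  { Obj       = Arr
  ; _⇒_       = Fact
  ; _≈_       = λ (u , v , _) (u′ , v′ , _) → (u ≈ u′) × (v ≈ v′)
  ; id        = id , id , Equiv.trans identityˡ identityʳ
  ; _∘_       = λ {a} {b} {c} → compose a b c
  ; equiv     = record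
    { refl  = Equiv.refl , Equiv.refl
    ; sym   = λ (p , q) → Equiv.sym p , Equiv.sym q
    ; trans = λ (p , q) (p′ , q′) → Equiv.trans p p′ , Equiv.trans q q′
    }
  ; assoc     = assoc , Equiv.sym assoc
  ; identityˡ = identityˡ , identityʳ
  ; identityʳ = identityʳ , identityˡ
  ; ∘-resp-≈  = λ (p , q) (p′ , q′) → ∘-resp-≈ p p′ , ∘-resp-≈ q′ q
  }
  where
  open Category V
  open HomReasoning

  Arr : Set ℓ
  Arr = Σ Obj λ X → Σ Obj λ Y → X ⇒ Y

  Fact : Arr → Arr → Set ℓ
  Fact (X , Y , f) (X′ , Y′ , g) = Σ (X ⇒ X′) λ u → Σ (Y′ ⇒ Y) λ v → v ∘ g ∘ u ≈ f

  compose : ∀ a b c → Fact b c → Fact a b → Fact a c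
  compose (_ , _ , f) (_ , _ , g) (_ , _ , h) (u′ , v′ , p′) (u , v , p) =
    u′ ∘ u , v ∘ v′ , (begin
      (v ∘ v′) ∘ h ∘ u′ ∘ u  ≈⟨ assoc ⟩
      v ∘ v′ ∘ h ∘ u′ ∘ u    ≈⟨ ∘-resp-≈ʳ (∘-resp-≈ʳ (Equiv.sym assoc)) ⟩
      v ∘ v′ ∘ (h ∘ u′) ∘ u  ≈⟨ ∘-resp-≈ʳ (Equiv.sym assoc) ⟩
      v ∘ (v′ ∘ h ∘ u′) ∘ u  ≈⟨ ∘-resp-≈ʳ (∘-resp-≈ˡ p′) ⟩
      v ∘ g ∘ u              ≈⟨ p ⟩
      f                      ∎)

opaque
  coend : {V : Category ℓ ℓ} {E : Category o ℓ} → Cocomplete E →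
          (T : Functor (op V ⊠ V) E) → Coend T
  coend {V = V} {E = E} cocomplete T = record
    { cowedge  = record
      { apex  = Colim.apex
      ; ψ     = λ X → Colim.ψ (X , X , V.id)
      ; dinat = λ {X} {Y} f → Equiv.trans (Colim.nat (toCod f)) (Equiv.sym (Colim.nat (toDom f)))
      }
    ; factor   = λ K → Colim.factor (toCocone K)
    ; commutes = λ K X → Equiv.trans (Colim.commutes (toCocone K) (X , X , V.id))
                           (Equiv.trans (∘-resp-≈ʳ identity) identityʳ)
    ; unique   = λ K h p → Colim.unique (toCocone K) h λ (X , Y , f) → begin
        h ∘ Colim.ψ (X , Y , f)                         ≈⟨ ∘-resp-≈ʳ (Equiv.sym (Colim.nat (toDom f))) ⟩
        h ∘ Colim.ψ (X , X , V.id) ∘ F₁ (f , V.id)      ≈⟨ Equiv.sym assoc ⟩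
        (h ∘ Colim.ψ (X , X , V.id)) ∘ F₁ (f , V.id)    ≈⟨ ∘-resp-≈ˡ (p X) ⟩
        Cowedge.ψ K X ∘ F₁ (f , V.id)                   ∎
    }
    where
    module V = Category V
    open Category E
    open Functor T
    open HomReasoning

    D : Functor (Factorisations V) E
    D = record
      { F₀ = λ (X , Y , f) → F₀ (Y , X)
      ; F₁ = λ (u , v , _) → F₁ (v , u)
      ; identity     = identity
      ; homomorphism = homomorphism
      ; F-resp-≈     = λ (p , q) → F-resp-≈ (q , p)
      }

    module Colim = Colimit (cocomplete (Factorisations V) D)

    toDom : ∀ {X Y} (f : X V.⇒ Y) → Factorisations V [ (X , Y , f) , (X , X , V.id) ]
    toDom f = V.id , f , V.Equiv.trans (V.∘-resp-≈ʳ V.identityˡ) V.identityʳ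

    toCod : ∀ {X Y} (f : X V.⇒ Y) → Factorisations V [ (X , Y , f) , (Y , Y , V.id) ]
    toCod f = f , V.id , V.Equiv.trans V.identityˡ V.identityˡ

    toCocone : Cowedge T → Cocone D
    toCocone K = record
      { apex = apex
      ; ψ    = λ (X , Y , f) → ψ X ∘ F₁ (f , V.id)
      ; nat  = λ {(X , Y , f)} {(X′ , Y′ , g)} (u , v , p) → begin
          (ψ X′ ∘ F₁ (g , V.id)) ∘ F₁ (v , u)     ≈⟨ assoc ⟩
          ψ X′ ∘ F₁ (g , V.id) ∘ F₁ (v , u)       ≈⟨ ∘-resp-≈ʳ (Equiv.sym homomorphism) ⟩
          ψ X′ ∘ F₁ (v V.∘ g , V.id V.∘ u)        ≈⟨ ∘-resp-≈ʳ (F-resp-≈ (V.Equiv.sym V.identityʳ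
                                                       , V.Equiv.trans V.identityˡ (V.Equiv.sym V.identityʳ))) ⟩
          ψ X′ ∘ F₁ ((v V.∘ g) V.∘ V.id , u V.∘ V.id) ≈⟨ ∘-resp-≈ʳ homomorphism ⟩
          ψ X′ ∘ F₁ (V.id , u) ∘ F₁ (v V.∘ g , V.id)  ≈⟨ Equiv.sym assoc ⟩
          (ψ X′ ∘ F₁ (V.id , u)) ∘ F₁ (v V.∘ g , V.id) ≈⟨ ∘-resp-≈ˡ (dinat u) ⟩
          (ψ X ∘ F₁ (u , V.id)) ∘ F₁ (v V.∘ g , V.id) ≈⟨ assoc ⟩
          ψ X ∘ F₁ (u , V.id) ∘ F₁ (v V.∘ g , V.id)   ≈⟨ ∘-resp-≈ʳ (Equiv.sym homomorphism) ⟩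
          ψ X ∘ F₁ ((v V.∘ g) V.∘ u , V.id V.∘ V.id)  ≈⟨ ∘-resp-≈ʳ (F-resp-≈
                                                       (V.Equiv.trans V.assoc p , V.identityˡ)) ⟩
          ψ X ∘ F₁ (f , V.id)                     ∎
      }
      where open Cowedge K

module KanExtension {V : Category ℓ ℓ} {A : Category o₁ ℓ} {E : Category o₂ ℓ}
                    (cocomplete : Cocomplete E) (J : Functor V A) where
  private
    module V = Category V
    module A = Category A
    module J = Functor J
  open Category E
  open Copowers cocomplete
  open NaturalTransformation using (η; commute)

  -- (V′ , V) ↦ 𝓐(J V′, X) · F V.
  integrand : A.Obj → Functor V E → Functor (op V ⊠ V) E
  integrand X F = copower ∘F ⟨ Hom[ A ] ∘F ⟨ opF J ∘F π₁ , constF X ⟩ , F ∘F π₂ ⟩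

  Lan-coend : (X : A.Obj) (F : Functor V E) → Coend (integrand X F)
  Lan-coend X F = coend cocomplete (integrand X F)

  private
    integrand-ι : ∀ X F {U U′ W W′} (f : U′ V.⇒ U) (g : W V.⇒ W′) (s : J.F₀ U A.⇒ X) →
                  Functor.F₁ (integrand X F) {U , W} {U′ , W′} (f , g) ∘ ι s
                  ≈ ι {A.hom-setoid (J.F₀ U′) X} (s A.∘ J.F₁ f) ∘ Functor.F₁ F g
    integrand-ι X F f g s = Equiv.trans
      (·₁-ι (Functor.F₁ Hom[ A ] (J.F₁ f , A.id)) (Functor.F₁ F g) s)
      (∘-resp-≈ˡ (ι-cong A.identityˡ))

    J-id : ∀ {U X} (s : J.F₀ U A.⇒ X) → s A.∘ J.F₁ V.id A.≈ s
    J-id s = A.Equiv.trans (A.∘-resp-≈ʳ J.identity) A.identityʳ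

  opaque
    Lan₀ : A.Obj → Functor V E → Obj
    Lan₀ X F = Coend.apex (Lan-coend X F)

    inj : ∀ {X F} U → J.F₀ U A.⇒ X → Functor.F₀ F U ⇒ Lan₀ X F
    inj {X} {F} U s = Coend.ψ (Lan-coend X F) U ∘ ι s

  opaque
    unfolding Lan₀ inj

    inj-cong : ∀ {X F U} {s t : J.F₀ U A.⇒ X} → s A.≈ t → inj {X} {F} U s ≈ inj {X} {F} U t
    inj-cong p = ∘-resp-≈ʳ (ι-cong p)

    inj-dinat : ∀ {X F U W} (f : U V.⇒ W) (s : J.F₀ W A.⇒ X) →
                inj {X} {F} W s ∘ Functor.F₁ F f ≈ inj {X} {F} U (s A.∘ J.F₁ f)
    inj-dinat {X} {F} {U} {W} f s = begin
      (C.ψ W ∘ ι s) ∘ F.F₁ f          ≈⟨ assoc ⟩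
      C.ψ W ∘ ι s ∘ F.F₁ f            ≈⟨ ∘-resp-≈ʳ (∘-resp-≈ˡ (ι-cong (A.Equiv.sym (J-id s)))) ⟩
      C.ψ W ∘ ι (s A.∘ J.F₁ V.id) ∘ F.F₁ f
                                      ≈⟨ ∘-resp-≈ʳ (Equiv.sym (integrand-ι X F V.id f s)) ⟩
      C.ψ W ∘ T.F₁ (V.id , f) ∘ ι s   ≈⟨ Equiv.sym assoc ⟩
      (C.ψ W ∘ T.F₁ (V.id , f)) ∘ ι s ≈⟨ ∘-resp-≈ˡ (C.dinat f) ⟩
      (C.ψ U ∘ T.F₁ (f , V.id)) ∘ ι s ≈⟨ assoc ⟩
      C.ψ U ∘ T.F₁ (f , V.id) ∘ ι s   ≈⟨ ∘-resp-≈ʳ (integrand-ι X F f V.id s) ⟩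
      C.ψ U ∘ ι (s A.∘ J.F₁ f) ∘ F.F₁ V.id
                                      ≈⟨ ∘-resp-≈ʳ (Equiv.trans (∘-resp-≈ʳ F.identity) identityʳ) ⟩
      C.ψ U ∘ ι (s A.∘ J.F₁ f)        ∎
      where
      open HomReasoning
      module F = Functor F
      module T = Functor (integrand X F)
      module C = Coend (Lan-coend X F)

    inj-ext : ∀ {X F Y} {h k : Lan₀ X F ⇒ Y} →
              (∀ U (s : J.F₀ U A.⇒ X) → h ∘ inj {X} {F} U s ≈ k ∘ inj {X} {F} U s) → h ≈ k
    inj-ext {X} {F} p = Coend.ext (Lan-coend X F) λ U → ·-ext λ s →
      Equiv.trans assoc (Equiv.trans (p U s) (Equiv.sym assoc))

  module _ {X : A.Obj} {F : Functor V E} {Y : Obj}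
           (t : ∀ U → Func (A.hom-setoid (J.F₀ U) X) (hom-setoid (Functor.F₀ F U) Y))
           (t-dinat : ∀ {U W} (f : U V.⇒ W) (s : J.F₀ W A.⇒ X) →
                      Func.to (t W) s ∘ Functor.F₁ F f ≈ Func.to (t U) (s A.∘ J.F₁ f)) where
    private
      module F = Functor F
      module T = Functor (integrand X F)

      cowedge : Cowedge (integrand X F)
      cowedge = record
        { apex  = Y
        ; ψ     = λ U → copair (t U)
        ; dinat = λ {U} {W} f → ·-ext λ s → begin
            (copair (t W) ∘ T.F₁ (V.id , f)) ∘ ι s           ≈⟨ assoc ⟩
            copair (t W) ∘ T.F₁ (V.id , f) ∘ ι s             ≈⟨ ∘-resp-≈ʳ (integrand-ι X F V.id f s) ⟩
            copair (t W) ∘ ι (s A.∘ J.F₁ V.id) ∘ F.F₁ f      ≈⟨ Equiv.sym assoc ⟩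
            (copair (t W) ∘ ι (s A.∘ J.F₁ V.id)) ∘ F.F₁ f    ≈⟨ ∘-resp-≈ˡ (copair-ι (t W) _) ⟩
            Func.to (t W) (s A.∘ J.F₁ V.id) ∘ F.F₁ f         ≈⟨ ∘-resp-≈ˡ (Func.cong (t W) (J-id s)) ⟩
            Func.to (t W) s ∘ F.F₁ f                         ≈⟨ t-dinat f s ⟩
            Func.to (t U) (s A.∘ J.F₁ f)                     ≈⟨ Equiv.sym (copair-ι (t U) _) ⟩
            copair (t U) ∘ ι (s A.∘ J.F₁ f)                  ≈⟨ ∘-resp-≈ʳ (Equiv.sym
                                                                  (Equiv.trans (∘-resp-≈ʳ F.identity) identityʳ)) ⟩
            copair (t U) ∘ ι (s A.∘ J.F₁ f) ∘ F.F₁ V.id      ≈⟨ ∘-resp-≈ʳ (Equiv.sym (integrand-ι X F f V.id s)) ⟩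
            copair (t U) ∘ T.F₁ (f , V.id) ∘ ι s             ≈⟨ Equiv.sym assoc ⟩
            (copair (t U) ∘ T.F₁ (f , V.id)) ∘ ι s           ∎
        }
        where open HomReasoning

    opaque
      unfolding Lan₀ inj

      desc : Lan₀ X F ⇒ Y
      desc = Coend.factor (Lan-coend X F) cowedge

      desc-inj : ∀ U (s : J.F₀ U A.⇒ X) → desc ∘ inj {X} {F} U s ≈ Func.to (t U) s
      desc-inj U s = Equiv.trans (Equiv.sym assoc)
        (Equiv.trans (∘-resp-≈ˡ (Coend.commutes (Lan-coend X F) cowedge U)) (copair-ι (t U) s))

  module _ {X X′ : A.Obj} {F F′ : Functor V E}
           (g : X A.⇒ X′) (τ : NaturalTransformation F F′) where
    private
      t : ∀ U → Func (A.hom-setoid (J.F₀ U) X) (hom-setoid (Functor.F₀ F U) (Lan₀ X′ F′))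
      t U = record
        { to   = λ s → inj U (g A.∘ s) ∘ η τ U
        ; cong = λ p → ∘-resp-≈ˡ (inj-cong (A.∘-resp-≈ʳ p))
        }

      t-dinat : ∀ {U W} (f : U V.⇒ W) (s : J.F₀ W A.⇒ X) →
                Func.to (t W) s ∘ Functor.F₁ F f ≈ Func.to (t U) (s A.∘ J.F₁ f)
      t-dinat {U} {W} f s = begin
        (inj W (g A.∘ s) ∘ η τ W) ∘ Functor.F₁ F f   ≈⟨ assoc ⟩
        inj W (g A.∘ s) ∘ η τ W ∘ Functor.F₁ F f     ≈⟨ ∘-resp-≈ʳ (commute τ f) ⟩
        inj W (g A.∘ s) ∘ Functor.F₁ F′ f ∘ η τ U    ≈⟨ Equiv.sym assoc ⟩
        (inj W (g A.∘ s) ∘ Functor.F₁ F′ f) ∘ η τ U  ≈⟨ ∘-resp-≈ˡ (inj-dinat f (g A.∘ s)) ⟩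
        inj U ((g A.∘ s) A.∘ J.F₁ f) ∘ η τ U         ≈⟨ ∘-resp-≈ˡ (inj-cong A.assoc) ⟩
        inj U (g A.∘ s A.∘ J.F₁ f) ∘ η τ U           ∎
        where open HomReasoning

    Lan₁ : Lan₀ X F ⇒ Lan₀ X′ F′
    Lan₁ = desc t t-dinat

    Lan₁-inj : ∀ U (s : J.F₀ U A.⇒ X) → Lan₁ ∘ inj U s ≈ inj U (g A.∘ s) ∘ η τ U
    Lan₁-inj = desc-inj t t-dinat

  -- (X , F) ↦ ∫^V 𝓐(J V, X) · F V, functorial in both variables.
  LanBi : Functor (A ⊠ Functors V E) E
  LanBi = record
    { F₀ = λ (X , F) → Lan₀ X F
    ; F₁ = λ (g , τ) → Lan₁ g τ
    ; identity     = inj-ext λ U s →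
        Equiv.trans (Lan₁-inj A.id idN U s)
          (Equiv.trans identityʳ
            (Equiv.trans (inj-cong A.identityˡ) (Equiv.sym identityˡ)))
    ; homomorphism = λ {_} {_} {_} {(g , τ)} {(g′ , τ′)} → inj-ext λ U s → begin
        Lan₁ (g′ A.∘ g) (τ′ ∘N τ) ∘ inj U s           ≈⟨ Lan₁-inj (g′ A.∘ g) (τ′ ∘N τ) U s ⟩
        inj U ((g′ A.∘ g) A.∘ s) ∘ η τ′ U ∘ η τ U     ≈⟨ ∘-resp-≈ˡ (inj-cong A.assoc) ⟩
        inj U (g′ A.∘ g A.∘ s) ∘ η τ′ U ∘ η τ U       ≈⟨ Equiv.sym assoc ⟩
        (inj U (g′ A.∘ g A.∘ s) ∘ η τ′ U) ∘ η τ U     ≈⟨ ∘-resp-≈ˡ (Equiv.sym (Lan₁-inj g′ τ′ U (g A.∘ s))) ⟩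
        (Lan₁ g′ τ′ ∘ inj U (g A.∘ s)) ∘ η τ U        ≈⟨ assoc ⟩
        Lan₁ g′ τ′ ∘ inj U (g A.∘ s) ∘ η τ U          ≈⟨ ∘-resp-≈ʳ (Equiv.sym (Lan₁-inj g τ U s)) ⟩
        Lan₁ g′ τ′ ∘ Lan₁ g τ ∘ inj U s               ≈⟨ Equiv.sym assoc ⟩
        (Lan₁ g′ τ′ ∘ Lan₁ g τ) ∘ inj U s             ∎
    ; F-resp-≈     = λ {_} {_} {(g , τ)} {(g′ , τ′)} (p , q) → inj-ext λ U s →
        Equiv.trans (Lan₁-inj g τ U s)
          (Equiv.trans (∘-resp-≈ (inj-cong (A.∘-resp-≈ˡ p)) (q U))
            (Equiv.sym (Lan₁-inj g′ τ′ U s)))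
    }
    where open HomReasoning

  Lan : Functor V E → Functor A E
  Lan F = LanBi ⟨–, F ⟩

-- F_J (A , B) = ∫^V 𝓐(J V, A) · F(V , B), for which F_J (– , B) = Lan_J F(– , B).
J-extension : {V : Category ℓ ℓ} {A : Category o ℓ} → Cocomplete A → Functor V A →
              Functor (V ⊠ A) A → Functor (A ⊠ A) A
J-extension cocomplete J F = LanBi ∘F ⟨ π₁ , curryF F ∘F π₂ ⟩
  where open KanExtension cocomplete J

-- The canonical map Lan_J (G F) X → G ((Lan_J F) X), given on the copower
-- summand at s : J U → X by G applied to the coprojection F U → (Lan_J F) X.
module _ {V : Category ℓ ℓ} {A : Category o₁ ℓ} {B : Category o₂ ℓ} {E : Category o₃ ℓ}
         (B-cocomplete : Cocomplete B) (E-cocomplete : Cocomplete E)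
         (J : Functor V A) (F : Functor V B) (G : Functor B E) where
  private
    module LB = KanExtension B-cocomplete J
    module LE = KanExtension E-cocomplete J
    module A = Category A
    module G = Functor G

  Lan-comparison : (X : A.Obj) → E [ Functor.F₀ (LE.Lan (G ∘F F)) X
                                   , G.F₀ (Functor.F₀ (LB.Lan F) X) ]
  Lan-comparison X = LE.desc
    (λ U → record
      { to   = λ s → G.F₁ (LB.inj U s)
      ; cong = λ p → G.F-resp-≈ (LB.inj-cong p)
      })
    (λ f s → Equiv.trans (Equiv.sym G.homomorphism) (G.F-resp-≈ (LB.inj-dinat f s)))
    where open Category E

-- `preserves` says that each component 𝓐(J U, –) of the nerve preserves
-- Lan_J F, where Lan_J (𝓐(J U, F –)) is formed in setoids.
record WellBehaved {V : Category ℓ ℓ} {A : Category o ℓ} (cocomplete : Cocomplete A)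
                   (J F : Functor V A) : Set (o ⊔ ℓ) where
  no-eta-equality
  field
    fullyFaithful : FullyFaithful J
    dense         : Dense J
    preserves     : ∀ U X → Category.IsIso (Setoids ℓ)
      (Lan-comparison cocomplete Setoids-cocomplete J F Hom[ A ][ Functor.F₀ J U ,–] X)

record Monoidal (V : Category o ℓ) : Set (o ⊔ ℓ) where
  no-eta-equality
  open Category V
  field
    ⊗    : Functor (V ⊠ V) V
    unit : Obj

  infixr 8 _⊗₀_ _⊗₁_ _⊗F_

  _⊗₀_ : Obj → Obj → Obj
  X ⊗₀ Y = Functor.F₀ ⊗ (X , Y)

  _⊗₁_ : ∀ {X Y X′ Y′} → X ⇒ X′ → Y ⇒ Y′ → X ⊗₀ Y ⇒ X′ ⊗₀ Y′
  f ⊗₁ g = Functor.F₁ ⊗ (f , g)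

  _⊗F_ : ∀ {o′ ℓ′} {X : Category o′ ℓ′} → Functor X V → Functor X V → Functor X V
  F ⊗F G = ⊗ ∘F ⟨ F , G ⟩

  field
    associator : let X = π₁ ; Y = π₁ ∘F π₂ ; Z = π₂ ∘F π₂ in
                 _≅_ {C = V ⊠ V ⊠ V} ((X ⊗F Y) ⊗F Z) (X ⊗F (Y ⊗F Z))
    unitorˡ    : (constF unit ⊗F idF) ≅ idF
    unitorʳ    : (idF ⊗F constF unit) ≅ idF

  α⇒ : ∀ X Y Z → (X ⊗₀ Y) ⊗₀ Z ⇒ X ⊗₀ (Y ⊗₀ Z)
  α⇒ X Y Z = _≅_.η associator (X , Y , Z)

  λ⇒ : ∀ X → unit ⊗₀ X ⇒ X
  λ⇒ = _≅_.η unitorˡ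

  ρ⇒ : ∀ X → X ⊗₀ unit ⇒ X
  ρ⇒ = _≅_.η unitorʳ

  field
    triangle : ∀ {X Y} → (id ⊗₁ λ⇒ Y) ∘ α⇒ X unit Y ≈ ρ⇒ X ⊗₁ id
    pentagon : ∀ {W X Y Z} →
      (id ⊗₁ α⇒ X Y Z) ∘ α⇒ W (X ⊗₀ Y) Z ∘ (α⇒ W X Y ⊗₁ id)
      ≈ α⇒ W X (Y ⊗₀ Z) ∘ α⇒ (W ⊗₀ X) Y Z

-- As for monoidal categories, the pentagon and the triangle with the unit in
-- the middle suffice: the compatibility of υ with μ at I ◁ (U ◁ X) follows.
record Action {V : Category o₁ ℓ₁} (M : Monoidal V) (A : Category o₂ ℓ₂) :
              Set (o₁ ⊔ ℓ₁ ⊔ o₂ ⊔ ℓ₂) where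
  no-eta-equality
  private
    module V = Category V
    module M = Monoidal M
  open Category A
  open M using (_⊗₀_; _⊗F_)
  field
    ◁ : Functor (V ⊠ A) A

  infixr 8 _◁₀_ _◁₁_ _◁F_

  _◁₀_ : V.Obj → Obj → Obj
  U ◁₀ X = Functor.F₀ ◁ (U , X)

  _◁₁_ : ∀ {U U′ X X′} → U V.⇒ U′ → X ⇒ X′ → U ◁₀ X ⇒ U′ ◁₀ X′
  f ◁₁ g = Functor.F₁ ◁ (f , g)

  _◁F_ : ∀ {o′ ℓ′} {C : Category o′ ℓ′} → Functor C V → Functor C A → Functor C A
  F ◁F G = ◁ ∘F ⟨ F , G ⟩

  field
    actUnit  : (constF M.unit ◁F idF) ≅ idF
    actAssoc : let W = π₁ ; U = π₁ ∘F π₂ ; X = π₂ ∘F π₂ in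
               _≅_ {C = V ⊠ V ⊠ A} (W ◁F (U ◁F X)) ((W ⊗F U) ◁F X)

  υ⇒ : ∀ X → M.unit ◁₀ X ⇒ X
  υ⇒ = _≅_.η actUnit

  μ⇒ : ∀ W U X → W ◁₀ (U ◁₀ X) ⇒ (W ⊗₀ U) ◁₀ X
  μ⇒ W U X = _≅_.η actAssoc (W , U , X)

  field
    triangle : ∀ {U X} → (M.ρ⇒ U ◁₁ id) ∘ μ⇒ U M.unit X ≈ V.id ◁₁ υ⇒ X
    pentagon : ∀ {T U W X} →
      (M.α⇒ T U W ◁₁ id) ∘ μ⇒ (T ⊗₀ U) W X ∘ μ⇒ T U (W ◁₀ X)
      ≈ μ⇒ T (U ⊗₀ W) X ∘ (V.id ◁₁ μ⇒ U W X)

{-# OPTIONS --safe #-}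
module Submission where

-- All four isomorphisms are calculations with coends.  Full faithfulness of J
-- and the co-Yoneda lemma give γ, and λ is γ at the unit followed by
-- I ◁ A ≅ A.  Density says that Lan_J J ≅ 1, whence ρ.  For α, well-behavedness
-- presents an arrow J W → A ◁_J B as a class of pairs J V → A, J W → V ◁ B,
-- so that (A ◁_J B) ◁_J C is ∫^V 𝓐(J V, A) · ((V ◁ B) ◁_J C), to which 𝐚 applies.

open import Defs
open import Level using (Level)
open import Data.Product using (_×_; _,_; proj₁; proj₂)
open import Function.Bundles using (Func)
open import Relation.Binary using (Setoid)

private
  variable
    o o₁ o₂ o₃ ℓ ℓ₁ ℓ₂ : Level

-- Generalities on isomorphisms, functors and natural isomorphisms.

module _ {C : Category o ℓ} where
  open Category C

  IsIso-id : ∀ {X} → IsIso (id {X})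
  IsIso-id = record { inv = id ; isoˡ = identityˡ ; isoʳ = identityˡ }

  IsIso-∘ : ∀ {X Y Z} {g : Y ⇒ Z} {f : X ⇒ Y} → IsIso g → IsIso f → IsIso (g ∘ f)
  IsIso-∘ {g = g} {f = f} G F = record
    { inv  = F.inv ∘ G.inv
    ; isoˡ = cancel f G.inv F.inv g F.isoˡ G.isoˡ
    ; isoʳ = cancel G.inv f g F.inv G.isoʳ F.isoʳ
    }
    where
    module F = IsIso F
    module G = IsIso G
    -- Neither pair is assumed to be a two-sided inverse, so one computation serves for both `isoˡ`
    -- and `isoʳ`.
    cancel : ∀ {W X Y} (a : W ⇒ X) (b : Y ⇒ X) (c : X ⇒ W) (d : X ⇒ Y) →
             c ∘ a ≈ id → b ∘ d ≈ id → (c ∘ b) ∘ d ∘ a ≈ id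
    cancel a b c d p q = begin
      (c ∘ b) ∘ d ∘ a  ≈⟨ assoc ⟩
      c ∘ b ∘ d ∘ a    ≈⟨ ∘-resp-≈ʳ (Equiv.sym assoc) ⟩
      c ∘ (b ∘ d) ∘ a  ≈⟨ ∘-resp-≈ʳ (∘-resp-≈ˡ q) ⟩
      c ∘ id ∘ a       ≈⟨ ∘-resp-≈ʳ identityˡ ⟩
      c ∘ a            ≈⟨ p ⟩
      id               ∎
      where open HomReasoning

module _ {C : Category o₁ ℓ₁} {D : Category o₂ ℓ₂} where

  ⊠-IsIso : ∀ {X X′ Y Y′} {f : C [ X , X′ ]} {g : D [ Y , Y′ ]} →
            Category.IsIso C f → Category.IsIso D g → Category.IsIso (C ⊠ D) (f , g)
  ⊠-IsIso p q = record
    { inv  = P.inv , Q.inv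
    ; isoˡ = P.isoˡ , Q.isoˡ
    ; isoʳ = P.isoʳ , Q.isoʳ
    }
    where
    module P = Category.IsIso p
    module Q = Category.IsIso q

module _ {C : Category o₁ ℓ₁} {D : Category o₂ ℓ₂} {F G : Functor C D} where
  open Category D
  open HomReasoning

  ≅-sym : F ≅ G → G ≅ F
  ≅-sym σ = record
    { to    = record { η = inv ; commute = inv-natural }
    ; isIso = λ X → record { inv = σ.η X ; isoˡ = isoʳ X ; isoʳ = isoˡ X }
    }
    where
    module F = Functor F
    module G = Functor G
    module σ = _≅_ σ
    module _ (X : Category.Obj C) where open IsIso (σ.isIso X) public
    inv-natural : ∀ {X Y} (f : C [ X , Y ]) → inv Y ∘ G.F₁ f ≈ F.F₁ f ∘ inv X
    inv-natural {X} {Y} f = begin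
      inv Y ∘ G.F₁ f                    ≈⟨ Equiv.sym identityʳ ⟩
      (inv Y ∘ G.F₁ f) ∘ id             ≈⟨ ∘-resp-≈ʳ (Equiv.sym (isoʳ X)) ⟩
      (inv Y ∘ G.F₁ f) ∘ σ.η X ∘ inv X  ≈⟨ assoc ⟩
      inv Y ∘ G.F₁ f ∘ σ.η X ∘ inv X    ≈⟨ ∘-resp-≈ʳ (Equiv.sym assoc) ⟩
      inv Y ∘ (G.F₁ f ∘ σ.η X) ∘ inv X  ≈⟨ ∘-resp-≈ʳ (∘-resp-≈ˡ (Equiv.sym (σ.commute f))) ⟩
      inv Y ∘ (σ.η Y ∘ F.F₁ f) ∘ inv X  ≈⟨ ∘-resp-≈ʳ assoc ⟩
      inv Y ∘ σ.η Y ∘ F.F₁ f ∘ inv X    ≈⟨ Equiv.sym assoc ⟩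
      (inv Y ∘ σ.η Y) ∘ F.F₁ f ∘ inv X  ≈⟨ ∘-resp-≈ˡ (isoˡ Y) ⟩
      id ∘ F.F₁ f ∘ inv X               ≈⟨ identityˡ ⟩
      F.F₁ f ∘ inv X                    ∎

Functor-IsIso : {C : Category o₁ ℓ₁} {D : Category o₂ ℓ₂} (F : Functor C D) →
                ∀ {X Y} {f : C [ X , Y ]} → Category.IsIso C f →
                Category.IsIso D (Functor.F₁ F f)
Functor-IsIso {D = D} F I = record
  { inv  = F.F₁ inv
  ; isoˡ = Equiv.trans (Equiv.sym F.homomorphism) (Equiv.trans (F.F-resp-≈ isoˡ) F.identity)
  ; isoʳ = Equiv.trans (Equiv.sym F.homomorphism) (Equiv.trans (F.F-resp-≈ isoʳ) F.identity)
  }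
  where
  module F = Functor F
  open Category.IsIso I
  open Category D

-- The inverses of the components are natural by `≅-sym`. In this form `LanBi`, a functor on a
-- functor category, carries a natural isomorphism of integrands to an isomorphism of coends.
Functors-IsIso : {C : Category ℓ₁ ℓ₁} {D : Category o₂ ℓ₂} {F G : Functor C D}
                 (σ : F ≅ G) → Category.IsIso (Functors C D) (_≅_.to σ)
Functors-IsIso σ = record
  { inv  = _≅_.to (≅-sym σ)
  ; isoˡ = λ X → Category.IsIso.isoˡ (_≅_.isIso σ X)
  ; isoʳ = λ X → Category.IsIso.isoʳ (_≅_.isIso σ X)
  }

-- Left Kan extension along a fully faithful functor.

module _ {V : Category ℓ ℓ} {A : Category o₁ ℓ} {E : Category o₂ ℓ}
         (cocomplete : Cocomplete E) (J : Functor V A) (J-ff : FullyFaithful J)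
         (F : Functor V E) where
  private
    module V = Category V
    module A = Category A
    module J = Functor J
    module F = Functor F
  open Category E
  open KanExtension cocomplete J
  open HomReasoning

  private
    lift : ∀ {U W} → J.F₀ U A.⇒ J.F₀ W → U V.⇒ W
    lift {U} {W} s = proj₁ (proj₂ (J-ff U W) s)

    J-lift : ∀ {U W} (s : J.F₀ U A.⇒ J.F₀ W) → J.F₁ (lift s) A.≈ s
    J-lift {U} {W} s = proj₂ (proj₂ (J-ff U W) s) V.Equiv.refl

    lift-unique : ∀ {U W} {s : J.F₀ U A.⇒ J.F₀ W} {f : U V.⇒ W} →
                  J.F₁ f A.≈ s → f V.≈ lift s
    lift-unique {U} {W} {s} p =
      proj₁ (J-ff U W) (A.Equiv.trans p (A.Equiv.sym (J-lift s)))

  -- Co-Yoneda: 𝓐(J U, J W) ≅ 𝓥(U, W), and the coend of 𝓥(U, W) · F U is F W. The inverse acts on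
  -- the summand at `s` by F applied to the unique arrow over `s`.
  Lan-along-FullyFaithful : ∀ W → IsIso (inj {J.F₀ W} {F} W A.id)
  Lan-along-FullyFaithful W = record
    { inv  = ev
    ; isoˡ = begin
        ev ∘ inj W A.id     ≈⟨ ev-inj W A.id ⟩
        F.F₁ (lift A.id)    ≈⟨ F.F-resp-≈ (V.Equiv.sym (lift-unique J.identity)) ⟩
        F.F₁ V.id           ≈⟨ F.identity ⟩
        id                  ∎
    ; isoʳ = inj-ext λ U s → begin
        (inj W A.id ∘ ev) ∘ inj U s     ≈⟨ assoc ⟩
        inj W A.id ∘ ev ∘ inj U s       ≈⟨ ∘-resp-≈ʳ (ev-inj U s) ⟩
        -- Dinaturality reindexes from the identity to J of `lift s`, which is `s` again: every
        -- summand factors through the one at the identity.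
        inj W A.id ∘ F.F₁ (lift s)      ≈⟨ inj-dinat (lift s) A.id ⟩
        inj U (A.id A.∘ J.F₁ (lift s))  ≈⟨ inj-cong (A.Equiv.trans A.identityˡ (J-lift s)) ⟩
        inj U s                         ≈⟨ Equiv.sym identityˡ ⟩
        id ∘ inj U s                    ∎
    }
    where
    t : ∀ U → Func (A.hom-setoid (J.F₀ U) (J.F₀ W)) (hom-setoid (F.F₀ U) (F.F₀ W))
    t U = record
      { to   = λ s → F.F₁ (lift s)
      ; cong = λ {r} p → F.F-resp-≈ (lift-unique (A.Equiv.trans (J-lift r) p))
      }
    t-dinat : ∀ {U U′} (f : U V.⇒ U′) (s : J.F₀ U′ A.⇒ J.F₀ W) →
              F.F₁ (lift s) ∘ F.F₁ f ≈ F.F₁ (lift (s A.∘ J.F₁ f))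
    -- The composite of `lift s` with `f` lies over the composite of `s` with J `f`.
    t-dinat f s = Equiv.trans (Equiv.sym F.homomorphism) (F.F-resp-≈ (lift-unique
      (A.Equiv.trans J.homomorphism (A.∘-resp-≈ˡ (J-lift s)))))
    ev : Lan₀ (J.F₀ W) F ⇒ F.F₀ W
    ev = desc t t-dinat
    ev-inj : ∀ U s → ev ∘ inj U s ≈ F.F₁ (lift s)
    ev-inj = desc-inj t t-dinat

-- Density and the canonical map Lan_J J → 1.

module _ {V : Category ℓ ℓ} {A : Category o ℓ} (cocomplete : Cocomplete A)
         (J : Functor V A) where
  private
    module V = Category V
    module J = Functor J
  open Category A
  open KanExtension cocomplete J
  open HomReasoning

  private
    t : ∀ X U → Func (hom-setoid (J.F₀ U) X) (hom-setoid (J.F₀ U) X)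
    t X U = Category.id (Setoids _)

  Lan-counit : ∀ X → Lan₀ X J ⇒ X
  Lan-counit X = desc (t X) (λ f s → Equiv.refl)

  Lan-counit-inj : ∀ {X} U (s : J.F₀ U ⇒ X) → Lan-counit X ∘ inj U s ≈ s
  Lan-counit-inj {X} = desc-inj (t X) (λ f s → Equiv.refl)

  -- The coprojections form a natural transformation of nerves, so fullness of the nerve produces a
  -- candidate inverse `k` with `k ∘ s` the coprojection at `s`. One composite is then checked on
  -- coprojections, the other through faithfulness of the nerve.
  Dense⇒Lan-counit-IsIso : Dense J → ∀ X → IsIso (Lan-counit X)
  Dense⇒Lan-counit-IsIso dense X = record
    { inv  = k
    ; isoˡ = inj-ext λ U s → begin
        (k ∘ ε) ∘ inj U s  ≈⟨ assoc ⟩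
        k ∘ ε ∘ inj U s    ≈⟨ ∘-resp-≈ʳ (Lan-counit-inj U s) ⟩
        k ∘ s              ≈⟨ k-∘ U s ⟩
        inj U s            ≈⟨ Equiv.sym identityˡ ⟩
        id ∘ inj U s       ∎
    -- The nerve acts on an arrow by composing it with `s ∘ J.F₁ V.id`, which is why J of an
    -- identity has to be removed and put back.
    ; isoʳ = proj₁ (dense X X) λ U s → begin
        (ε ∘ k) ∘ s ∘ J.F₁ V.id  ≈⟨ ∘-resp-≈ʳ (∘J-id s) ⟩
        (ε ∘ k) ∘ s              ≈⟨ assoc ⟩
        ε ∘ k ∘ s                ≈⟨ ∘-resp-≈ʳ (k-∘ U s) ⟩
        ε ∘ inj U s              ≈⟨ Lan-counit-inj U s ⟩
        s                        ≈⟨ Equiv.sym (∘J-id s) ⟩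
        s ∘ J.F₁ V.id            ≈⟨ Equiv.sym identityˡ ⟩
        id ∘ s ∘ J.F₁ V.id       ∎
    }
    where
    ε : Lan₀ X J ⇒ X
    ε = Lan-counit X

    ∘J-id : ∀ {U Y} (s : J.F₀ U ⇒ Y) → s ∘ J.F₁ V.id ≈ s
    ∘J-id s = Equiv.trans (∘-resp-≈ʳ J.identity) identityʳ

    coprojections : NaturalTransformation (Functor.F₀ (nerve J) X)
                                          (Functor.F₀ (nerve J) (Lan₀ X J))
    coprojections = record
      { η       = λ U → record { to = inj U ; cong = inj-cong }
      ; commute = λ {U} {W} f s → begin
          inj W (id ∘ s ∘ J.F₁ f)  ≈⟨ inj-cong identityˡ ⟩
          inj W (s ∘ J.F₁ f)       ≈⟨ Equiv.sym (inj-dinat f s) ⟩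
          inj U s ∘ J.F₁ f         ≈⟨ Equiv.sym identityˡ ⟩
          id ∘ inj U s ∘ J.F₁ f    ∎
      }

    k : X ⇒ Lan₀ X J
    k = proj₁ (proj₂ (dense X (Lan₀ X J)) coprojections)

    k-∘ : ∀ U (s : J.F₀ U ⇒ X) → k ∘ s ≈ inj U s
    k-∘ U s = Equiv.trans (∘-resp-≈ʳ (Equiv.sym (∘J-id s)))
      (proj₂ (proj₂ (dense X (Lan₀ X J)) coprojections) Equiv.refl U s)

-- Canonical comparisons and iterated left Kan extensions.

module _ {V : Category ℓ ℓ} {A : Category o₁ ℓ} {B : Category o₂ ℓ} {E : Category o₃ ℓ}
         (B-cocomplete : Cocomplete B) (E-cocomplete : Cocomplete E)
         (J : Functor V A) (F : Functor V B) (G : Functor B E) where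
  private
    module LB = KanExtension B-cocomplete J
    module LE = KanExtension E-cocomplete J

  Lan-comparison-inj : ∀ {X} U (s : A [ Functor.F₀ J U , X ]) →
    E [ E [ Lan-comparison B-cocomplete E-cocomplete J F G X ∘ LE.inj U s ]
      ≈ Functor.F₁ G (LB.inj U s) ]
  Lan-comparison-inj = LE.desc-inj _ _

module _ {V : Category ℓ ℓ} {A : Category o₁ ℓ} {E : Category o₂ ℓ}
         (cocomplete : Cocomplete E) (J : Functor V A) (H : Functor V E) where
  open Category E
  open KanExtension cocomplete J

  Lan-F₁-inj : ∀ {X Y} (g : A [ X , Y ]) U (s : A [ Functor.F₀ J U , X ]) →
               Functor.F₁ (Lan H) g ∘ inj U s ≈ inj U (A [ g ∘ s ])
  Lan-F₁-inj g U s = Equiv.trans (Lan₁-inj g (idN {F = H}) U s) identityʳ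

module _ {V : Category ℓ ℓ} {A : Category o₁ ℓ} {E : Category o₂ ℓ}
         (A-cocomplete : Cocomplete A) (E-cocomplete : Cocomplete E)
         (J F : Functor V A) (H : Functor V E) where
  private
    module V = Category V
    module A = Category A
    module J = Functor J
    module F = Functor F
    module H = Functor H
    module LA = KanExtension A-cocomplete J
    module LE = KanExtension E-cocomplete J
    module LS = KanExtension (Setoids-cocomplete {ℓ}) J

    nerve-F : V.Obj → Functor V (Setoids ℓ)
    nerve-F W = Hom[ A ][ J.F₀ W ,–] ∘F F

    nerve-comparison : ∀ W X → Setoids ℓ [ LS.Lan₀ X (nerve-F W)
                                         , A.hom-setoid (J.F₀ W) (LA.Lan₀ X F) ]
    nerve-comparison W = Lan-comparison A-cocomplete Setoids-cocomplete J F Hom[ A ][ J.F₀ W ,–]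

  open Category E
  open HomReasoning

  -- In coend form this goes from ∫^U 𝓐(J U, X) · ∫^W 𝓐(J W, F U) · H W to ∫^W 𝓐(J W, (Lan_J F) X) ·
  -- H W.
  iterated-comparison : ∀ X → LE.Lan₀ X (LE.Lan H ∘F F) ⇒ LE.Lan₀ (LA.Lan₀ X F) H
  iterated-comparison = Lan-comparison A-cocomplete E-cocomplete J F (LE.Lan H)

  iterated-comparison-inj : ∀ X U s →
    iterated-comparison X ∘ LE.inj U s ≈ Functor.F₁ (LE.Lan H) (LA.inj U s)
  iterated-comparison-inj X = Lan-comparison-inj A-cocomplete E-cocomplete J F (LE.Lan H)

  module _ (preserves : ∀ W X → Category.IsIso (Setoids ℓ) (nerve-comparison W X))
           (X : A.Obj) where
    private
      φ : LE.Lan₀ X (LE.Lan H ∘F F) ⇒ LE.Lan₀ (LA.Lan₀ X F) H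
      φ = iterated-comparison X

      inj-LF : ∀ U → J.F₀ U A.⇒ X → LE.Lan₀ (F.F₀ U) H ⇒ LE.Lan₀ X (LE.Lan H ∘F F)
      inj-LF = LE.inj {X} {LE.Lan H ∘F F}

      inj-H : ∀ {Y} W → J.F₀ W A.⇒ Y → H.F₀ W ⇒ LE.Lan₀ Y H
      inj-H {Y} = LE.inj {Y} {H}

      -- On summands, `φ` composes the pair `s`, `r` into one index. Inverting it therefore amounts
      -- to splitting an arrow J W → (Lan_J F) X into such a pair.
      φ-inj-inj : ∀ U s W (r : J.F₀ W A.⇒ F.F₀ U) →
                  (φ ∘ inj-LF U s) ∘ inj-H W r ≈ inj-H W (LA.inj U s A.∘ r)
      φ-inj-inj U s W r = begin
        (φ ∘ inj-LF U s) ∘ inj-H W r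
          ≈⟨ ∘-resp-≈ˡ (iterated-comparison-inj X U s) ⟩
        Functor.F₁ (LE.Lan H) (LA.inj U s) ∘ inj-H W r
          ≈⟨ Lan-F₁-inj E-cocomplete J H (LA.inj U s) W r ⟩
        inj-H W (LA.inj U s A.∘ r)  ∎

      module _ (W : V.Obj) where
        module N = Category.IsIso (preserves W X)

        -- Preservation of Lan_J F by the nerve supplies the splitting, as a class in the coend of
        -- setoids rather than as a chosen pair.
        decompose : J.F₀ W A.⇒ LA.Lan₀ X F → Setoid.Carrier (LS.Lan₀ X (nerve-F W))
        decompose = Func.to N.inv

        compose-decompose : ∀ t → Func.to (nerve-comparison W X) (decompose t) A.≈ t
        compose-decompose = N.isoʳ

        pairing-on : ∀ U → Func (A.hom-setoid (J.F₀ U) X)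
          (Category.hom-setoid (Setoids ℓ) (A.hom-setoid (J.F₀ W) (F.F₀ U))
                                           (hom-setoid (H.F₀ W) (LE.Lan₀ X (LE.Lan H ∘F F))))
        pairing-on U = record
          { to   = λ s → record
            { to   = λ r → inj-LF U s ∘ inj-H W r
            ; cong = λ p → ∘-resp-≈ʳ (LE.inj-cong p)
            }
          ; cong = λ p r → ∘-resp-≈ˡ (LE.inj-cong p)
          }

        -- The double coprojection depends only on the class of the pair: `f` slides from `r` to `s`
        -- because U is bound by the outer coend. The trailing identity comes from the action of the
        -- hom functor on arrows.
        pairing-dinat : ∀ {U U′} (f : U V.⇒ U′) (s : J.F₀ U′ A.⇒ X) (r : J.F₀ W A.⇒ F.F₀ U) →
          inj-LF U′ s ∘ inj-H W (F.F₁ f A.∘ r A.∘ A.id)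
          ≈ inj-LF U (s A.∘ J.F₁ f) ∘ inj-H W r
        pairing-dinat {U} {U′} f s r = begin
          inj-LF U′ s ∘ inj-H W (F.F₁ f A.∘ r A.∘ A.id)
            ≈⟨ ∘-resp-≈ʳ (LE.inj-cong (A.∘-resp-≈ʳ A.identityʳ)) ⟩
          inj-LF U′ s ∘ inj-H W (F.F₁ f A.∘ r)
            ≈⟨ ∘-resp-≈ʳ (Equiv.sym (Lan-F₁-inj E-cocomplete J H (F.F₁ f) W r)) ⟩
          inj-LF U′ s ∘ Functor.F₁ (LE.Lan H) (F.F₁ f) ∘ inj-H W r
            ≈⟨ Equiv.sym assoc ⟩
          (inj-LF U′ s ∘ Functor.F₁ (LE.Lan H) (F.F₁ f)) ∘ inj-H W r
            ≈⟨ ∘-resp-≈ˡ (LE.inj-dinat {F = LE.Lan H ∘F F} f s) ⟩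
          inj-LF U (s A.∘ J.F₁ f) ∘ inj-H W r  ∎

        pairing : Func (LS.Lan₀ X (nerve-F W)) (hom-setoid (H.F₀ W) (LE.Lan₀ X (LE.Lan H ∘F F)))
        pairing = LS.desc pairing-on pairing-dinat

        pairing-inj : ∀ U s r →
          Func.to pairing (Func.to (LS.inj U s) r) ≈ inj-LF U s ∘ inj-H W r
        pairing-inj = LS.desc-inj pairing-on pairing-dinat

        compose-inj : ∀ U s r →
          Func.to (nerve-comparison W X) (Func.to (LS.inj U s) r) A.≈ LA.inj U s A.∘ r
        compose-inj U s r = A.Equiv.trans
          (Lan-comparison-inj A-cocomplete Setoids-cocomplete J F Hom[ A ][ J.F₀ W ,–] U s r)
          (A.∘-resp-≈ʳ A.identityʳ)

        decompose-∘ : ∀ U s r →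
          Setoid._≈_ (LS.Lan₀ X (nerve-F W)) (decompose (LA.inj U s A.∘ r)) (Func.to (LS.inj U s) r)
        decompose-∘ U s r = Setoid.trans (LS.Lan₀ X (nerve-F W))
          (Func.cong N.inv (A.Equiv.sym (compose-inj U s r))) (N.isoˡ _)

        pairing-decompose : ∀ U s r →
          Func.to pairing (decompose (LA.inj U s A.∘ r)) ≈ inj-LF U s ∘ inj-H W r
        pairing-decompose U s r =
          Equiv.trans (Func.cong pairing (decompose-∘ U s r)) (pairing-inj U s r)

        -- Both sides are setoid maps out of a coend, so it is enough to look at the class of a
        -- pair. The maps `h` and `k` are written out because a pointwise equation does not
        -- determine them for unification.
        φ-pairing : ∀ x → φ ∘ Func.to pairing x ≈ inj-H W (Func.to (nerve-comparison W X) x)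
        φ-pairing = LS.inj-ext {Y = hom-setoid (H.F₀ W) (LE.Lan₀ (LA.Lan₀ X F) H)}
          {h = record { to   = λ x → φ ∘ Func.to pairing x
                      ; cong = λ p → ∘-resp-≈ʳ (Func.cong pairing p) }}
          {k = record { to   = λ x → inj-H W (Func.to (nerve-comparison W X) x)
                      ; cong = λ p → LE.inj-cong (Func.cong (nerve-comparison W X) p) }}
          λ U s r → begin
            φ ∘ Func.to pairing (Func.to (LS.inj U s) r)  ≈⟨ ∘-resp-≈ʳ (pairing-inj U s r) ⟩
            φ ∘ inj-LF U s ∘ inj-H W r                   ≈⟨ Equiv.sym assoc ⟩
            (φ ∘ inj-LF U s) ∘ inj-H W r                 ≈⟨ φ-inj-inj U s W r ⟩
            inj-H W (LA.inj U s A.∘ r)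
              ≈⟨ LE.inj-cong (A.Equiv.sym (compose-inj U s r)) ⟩
            inj-H W (Func.to (nerve-comparison W X) (Func.to (LS.inj U s) r)) ∎

      -- Restriction of a class along `f` is expressed by recomposing, precomposing with J `f` and
      -- decomposing again. On the class of `s`, `r` it merely replaces `r` by its composite with J
      -- `f`, which is dinaturality of the inner coend.
      pairing-natural : ∀ {W W′} (f : W V.⇒ W′) x →
        Func.to (pairing W′) x ∘ H.F₁ f
        ≈ Func.to (pairing W) (decompose W (Func.to (nerve-comparison W′ X) x A.∘ J.F₁ f))
      pairing-natural {W} {W′} f = LS.inj-ext {Y = hom-setoid (H.F₀ W) (LE.Lan₀ X (LE.Lan H ∘F F))}
        {h = record { to   = λ x → Func.to (pairing W′) x ∘ H.F₁ f
                    ; cong = λ p → ∘-resp-≈ˡ (Func.cong (pairing W′) p) }}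
        {k = record { to   = λ x → Func.to (pairing W)
                               (decompose W (Func.to (nerve-comparison W′ X) x A.∘ J.F₁ f))
                    ; cong = λ p → Func.cong (pairing W) (Func.cong (N.inv W) (A.∘-resp-≈ˡ
                               (Func.cong (nerve-comparison W′ X) p))) }}
        λ U s r → begin
          Func.to (pairing W′) (Func.to (LS.inj U s) r) ∘ H.F₁ f
            ≈⟨ ∘-resp-≈ˡ (pairing-inj W′ U s r) ⟩
          (inj-LF U s ∘ inj-H W′ r) ∘ H.F₁ f
            ≈⟨ assoc ⟩
          inj-LF U s ∘ inj-H W′ r ∘ H.F₁ f
            ≈⟨ ∘-resp-≈ʳ (LE.inj-dinat f r) ⟩
          inj-LF U s ∘ inj-H W (r A.∘ J.F₁ f)
            ≈⟨ Equiv.sym (pairing-decompose W U s (r A.∘ J.F₁ f)) ⟩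
          Func.to (pairing W) (decompose W (LA.inj U s A.∘ r A.∘ J.F₁ f))
            ≈⟨ Func.cong (pairing W) (Func.cong (N.inv W) (A.Equiv.trans (A.Equiv.sym A.assoc)
                 (A.∘-resp-≈ˡ (A.Equiv.sym (compose-inj W′ U s r))))) ⟩
          Func.to (pairing W)
            (decompose W (Func.to (nerve-comparison W′ X) (Func.to (LS.inj U s) r) A.∘ J.F₁ f)) ∎

      -- The inverse of `φ` on the summand at an arrow: split the arrow, then use the double
      -- coprojection at the resulting class.
      ψ-on : ∀ W → Func (A.hom-setoid (J.F₀ W) (LA.Lan₀ X F))
                        (hom-setoid (H.F₀ W) (LE.Lan₀ X (LE.Lan H ∘F F)))
      ψ-on W = Setoids ℓ [ pairing W ∘ N.inv W ]

      ψ-dinat : ∀ {W W′} (f : W V.⇒ W′) (t : J.F₀ W′ A.⇒ LA.Lan₀ X F) →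
                Func.to (ψ-on W′) t ∘ H.F₁ f ≈ Func.to (ψ-on W) (t A.∘ J.F₁ f)
      ψ-dinat {W} {W′} f t = Equiv.trans (pairing-natural f (decompose W′ t))
        (Func.cong (ψ-on W) (A.∘-resp-≈ˡ (compose-decompose W′ t)))

      ψ : LE.Lan₀ (LA.Lan₀ X F) H ⇒ LE.Lan₀ X (LE.Lan H ∘F F)
      ψ = LE.desc ψ-on ψ-dinat

      ψ-inj : ∀ W t → ψ ∘ inj-H W t ≈ Func.to (pairing W) (decompose W t)
      ψ-inj = LE.desc-inj ψ-on ψ-dinat

      ψ-inj-inj : ∀ U s W r → ψ ∘ inj-H W (LA.inj U s A.∘ r) ≈ inj-LF U s ∘ inj-H W r
      ψ-inj-inj U s W r = Equiv.trans (ψ-inj W _) (pairing-decompose W U s r)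

      ψ-φ-inj-inj : ∀ U s W (r : J.F₀ W A.⇒ F.F₀ U) →
        ((ψ ∘ φ) ∘ inj-LF U s) ∘ inj-H W r ≈ (id ∘ inj-LF U s) ∘ inj-H W r
      ψ-φ-inj-inj U s W r = begin
        ((ψ ∘ φ) ∘ inj-LF U s) ∘ inj-H W r  ≈⟨ ∘-resp-≈ˡ assoc ⟩
        (ψ ∘ φ ∘ inj-LF U s) ∘ inj-H W r    ≈⟨ assoc ⟩
        ψ ∘ (φ ∘ inj-LF U s) ∘ inj-H W r    ≈⟨ ∘-resp-≈ʳ (φ-inj-inj U s W r) ⟩
        ψ ∘ inj-H W (LA.inj U s A.∘ r)      ≈⟨ ψ-inj-inj U s W r ⟩
        inj-LF U s ∘ inj-H W r              ≈⟨ ∘-resp-≈ˡ (Equiv.sym identityˡ) ⟩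
        (id ∘ inj-LF U s) ∘ inj-H W r       ∎

      ψ-φ : ψ ∘ φ ≈ id
      -- The domain is a coend of coends, so extensionality is used once for each.
      ψ-φ = LE.inj-ext λ U s → LE.inj-ext λ W r → ψ-φ-inj-inj U s W r

      φ-ψ-inj : ∀ W t → (φ ∘ ψ) ∘ inj-H W t ≈ id ∘ inj-H W t
      φ-ψ-inj W t = begin
        (φ ∘ ψ) ∘ inj-H W t                     ≈⟨ assoc ⟩
        φ ∘ ψ ∘ inj-H W t                       ≈⟨ ∘-resp-≈ʳ (ψ-inj W t) ⟩
        φ ∘ Func.to (pairing W) (decompose W t)  ≈⟨ φ-pairing W (decompose W t) ⟩
        inj-H W (Func.to (nerve-comparison W X) (decompose W t))
                                                 ≈⟨ LE.inj-cong (compose-decompose W t) ⟩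
        inj-H W t                               ≈⟨ Equiv.sym identityˡ ⟩
        id ∘ inj-H W t                          ∎

      φ-ψ : φ ∘ ψ ≈ id
      φ-ψ = LE.inj-ext φ-ψ-inj

    -- The double coend formula for Lan_J H after Lan_J F: since the nerve of J
    -- preserves Lan_J F, an arrow J W → Lan_J F X is a class of pairs
    -- s : J U → X, r : J W → F U.
    Lan-preserves-Lan : IsIso (iterated-comparison X)
    Lan-preserves-Lan = record { inv = ψ ; isoˡ = ψ-φ ; isoʳ = φ-ψ }

-- The J-extension of a bifunctor and its restriction along J.

module _ {V : Category ℓ ℓ} {A : Category o ℓ} (cocomplete : Cocomplete A)
         (J : Functor V A) (T : Functor (V ⊠ A) A) where
  private
    module V = Category V
    module J = Functor J
    module T = Functor T
    T-J = J-extension cocomplete J T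
    module T-J = Functor T-J
  open Category A
  open KanExtension cocomplete J
  open HomReasoning

  J-extension-inj : ∀ {X X′ Y Y′} (f : X ⇒ X′) (g : Y ⇒ Y′) U (s : J.F₀ U ⇒ X) →
                    T-J.F₁ (f , g) ∘ inj U s ≈ inj U (f ∘ s) ∘ T.F₁ (V.id , g)
  J-extension-inj f g = Lan₁-inj f (Functor.F₁ (curryF T) g)

  -- The two agree definitionally on objects, but on arrows `T-J` inserts `T.F₁ (V.id , id)`, which
  -- is only provably the identity. This lets results on `Lan` apply to `T-J` one variable at a
  -- time.
  J-extension-Lan : ∀ Y {X X′} (f : X ⇒ X′) →
                    T-J.F₁ (f , id) ≈ Functor.F₁ (Lan (T ⟨–, Y ⟩)) f
  J-extension-Lan Y f = inj-ext λ U s → begin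
    T-J.F₁ (f , id) ∘ inj U s                   ≈⟨ J-extension-inj f id U s ⟩
    inj U (f ∘ s) ∘ T.F₁ (V.id , id)            ≈⟨ ∘-resp-≈ʳ T.identity ⟩
    inj U (f ∘ s) ∘ id                          ≈⟨ identityʳ ⟩
    inj U (f ∘ s)                               ≈⟨ Equiv.sym (Lan-F₁-inj cocomplete J (T ⟨–, Y ⟩) f U s) ⟩
    Functor.F₁ (Lan (T ⟨–, Y ⟩)) f ∘ inj U s    ∎

  -- Co-Yoneda in the first variable for each fixed second one. It is built backwards, since the
  -- coprojection at the identity is explicit and its naturality in both variables can be read off.
  J-extension-along : FullyFaithful J → (T-J ∘F ⟨ J ∘F π₁ , π₂ ⟩) ≅ T
  J-extension-along J-ff = ≅-sym (record
    { to    = record { η = coprojection ; commute = natural }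
    ; isIso = λ (W , Y) → Lan-along-FullyFaithful cocomplete J J-ff (T ⟨–, Y ⟩) W
    })
    where
    coprojection : ∀ ((W , Y) : V.Obj × Obj) → T.F₀ (W , Y) ⇒ T-J.F₀ (J.F₀ W , Y)
    coprojection (W , Y) = inj W id

    natural : ∀ {P Q} ((f , g) : (V ⊠ A) [ P , Q ]) →
              coprojection Q ∘ T.F₁ (f , g) ≈ T-J.F₁ (J.F₁ f , g) ∘ coprojection P
    natural {W , Y} {W′ , Y′} (f , g) = begin
      inj W′ id ∘ T.F₁ (f , g)
        -- The two variables are separated: dinaturality absorbs `f` into the index, while `g` is
        -- already how `T-J` acts on a summand.
        ≈⟨ ∘-resp-≈ʳ (T.F-resp-≈ (V.Equiv.sym V.identityʳ , Equiv.sym identityˡ)) ⟩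
      inj W′ id ∘ T.F₁ (f V.∘ V.id , id ∘ g)
        ≈⟨ ∘-resp-≈ʳ T.homomorphism ⟩
      inj W′ id ∘ T.F₁ (f , id) ∘ T.F₁ (V.id , g)
        ≈⟨ Equiv.sym assoc ⟩
      (inj W′ id ∘ T.F₁ (f , id)) ∘ T.F₁ (V.id , g)
        ≈⟨ ∘-resp-≈ˡ (inj-dinat {F = T ⟨–, Y′ ⟩} f id) ⟩
      inj W (id ∘ J.F₁ f) ∘ T.F₁ (V.id , g)
        ≈⟨ ∘-resp-≈ˡ (inj-cong (Equiv.trans identityˡ (Equiv.sym identityʳ))) ⟩
      inj W (J.F₁ f ∘ id) ∘ T.F₁ (V.id , g)
        ≈⟨ Equiv.sym (J-extension-inj (J.F₁ f) g W id) ⟩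
      T-J.F₁ (J.F₁ f , g) ∘ inj W id  ∎

  -- The associativity isomorphism.

  module _ (preserves : ∀ Y W X → Category.IsIso (Setoids ℓ)
              (Lan-comparison cocomplete Setoids-cocomplete J (T ⟨–, Y ⟩)
                 Hom[ A ][ J.F₀ W ,–] X))
           (𝐚 : _≅_ {C = V ⊠ A ⊠ A}
                  (T-J ∘F ⟨ T ∘F ⟨ π₁ , π₁ ∘F π₂ ⟩ , π₂ ∘F π₂ ⟩)
                  (T ∘F ⟨ π₁ , T-J ∘F ⟨ π₁ ∘F π₂ , π₂ ∘F π₂ ⟩ ⟩)) where
    private
      module 𝐚⁻¹ = _≅_ (≅-sym 𝐚)

      slice : ∀ Y Z → (T ⟨–, T-J.F₀ (Y , Z) ⟩) ≅ (Lan (T ⟨–, Z ⟩) ∘F (T ⟨–, Y ⟩))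
      slice Y Z = record
        { to    = record
          { η       = λ U → 𝐚⁻¹.η (U , Y , Z)
          ; commute = λ {U} {W} f → begin
              𝐚⁻¹.η (W , Y , Z) ∘ T.F₁ (f , id)
                -- Naturality of `𝐚` with the last two variables fixed involves `T-J.F₁ (id , id)`,
                -- where the slice has `id`.
                ≈⟨ ∘-resp-≈ʳ (T.F-resp-≈ (V.Equiv.refl , Equiv.sym T-J.identity)) ⟩
              𝐚⁻¹.η (W , Y , Z) ∘ T.F₁ (f , T-J.F₁ (id , id))
                ≈⟨ 𝐚⁻¹.commute (f , id , id) ⟩
              T-J.F₁ (T.F₁ (f , id) , id) ∘ 𝐚⁻¹.η (U , Y , Z)
                ≈⟨ ∘-resp-≈ˡ (J-extension-Lan Z (T.F₁ (f , id))) ⟩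
              Functor.F₁ (Lan (T ⟨–, Z ⟩)) (T.F₁ (f , id)) ∘ 𝐚⁻¹.η (U , Y , Z)  ∎
          }
        ; isIso = λ U → 𝐚⁻¹.isIso (U , Y , Z)
        }

      comparison : ∀ X Y Z →
                   Lan₀ X (Lan (T ⟨–, Z ⟩) ∘F (T ⟨–, Y ⟩)) ⇒ T-J.F₀ (T-J.F₀ (X , Y) , Z)
      comparison X Y Z = iterated-comparison cocomplete cocomplete J (T ⟨–, Y ⟩) (T ⟨–, Z ⟩) X

      comparison-isIso : ∀ X Y Z → IsIso (comparison X Y Z)
      comparison-isIso X Y Z =
        Lan-preserves-Lan cocomplete cocomplete J (T ⟨–, Y ⟩) (T ⟨–, Z ⟩) (preserves Y) X

      transfer : ∀ X Y Z → T-J.F₀ (X , T-J.F₀ (Y , Z)) ⇒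
                           Lan₀ X (Lan (T ⟨–, Z ⟩) ∘F (T ⟨–, Y ⟩))
      transfer X Y Z = Lan₁ id (_≅_.to (slice Y Z))

      transfer-isIso : ∀ X Y Z → IsIso (transfer X Y Z)
      transfer-isIso X Y Z =
        Functor-IsIso LanBi
          (⊠-IsIso {C = A} {D = Functors V A} IsIso-id (Functors-IsIso (slice Y Z)))

      α⁻¹ : ∀ ((X , Y , Z) : Category.Obj (A ⊠ A ⊠ A)) →
            T-J.F₀ (X , T-J.F₀ (Y , Z)) ⇒ T-J.F₀ (T-J.F₀ (X , Y) , Z)
      α⁻¹ (X , Y , Z) = comparison X Y Z ∘ transfer X Y Z

      -- This formula on summands is all that naturality of `α⁻¹` requires; the comparison and the
      -- transfer need not be shown natural separately.
      α⁻¹-inj : ∀ X Y Z U (s : J.F₀ U ⇒ X) →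
        α⁻¹ (X , Y , Z) ∘ inj U s ≈ T-J.F₁ (inj U s , id) ∘ 𝐚⁻¹.η (U , Y , Z)
      α⁻¹-inj X Y Z U s = begin
        (comparison X Y Z ∘ transfer X Y Z) ∘ inj U s
          ≈⟨ assoc ⟩
        comparison X Y Z ∘ transfer X Y Z ∘ inj U s
          ≈⟨ ∘-resp-≈ʳ (Lan₁-inj id (_≅_.to (slice Y Z)) U s) ⟩
        comparison X Y Z ∘ inj U (id ∘ s) ∘ 𝐚⁻¹.η (U , Y , Z)
          ≈⟨ ∘-resp-≈ʳ (∘-resp-≈ˡ (inj-cong identityˡ)) ⟩
        comparison X Y Z ∘ inj U s ∘ 𝐚⁻¹.η (U , Y , Z)
          ≈⟨ Equiv.sym assoc ⟩
        (comparison X Y Z ∘ inj U s) ∘ 𝐚⁻¹.η (U , Y , Z)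
          ≈⟨ ∘-resp-≈ˡ (iterated-comparison-inj cocomplete cocomplete J
                                                (T ⟨–, Y ⟩) (T ⟨–, Z ⟩) X U s) ⟩
        Functor.F₁ (Lan (T ⟨–, Z ⟩)) (inj U s) ∘ 𝐚⁻¹.η (U , Y , Z)
          ≈⟨ ∘-resp-≈ˡ (Equiv.sym (J-extension-Lan Z (inj U s))) ⟩
        T-J.F₁ (inj U s , id) ∘ 𝐚⁻¹.η (U , Y , Z)  ∎

      α⁻¹-natural-inj : ∀ {X X′ Y Y′ Z Z′} (f : X ⇒ X′) (g : Y ⇒ Y′) (h : Z ⇒ Z′)
        U (s : J.F₀ U ⇒ X) →
        (α⁻¹ (X′ , Y′ , Z′) ∘ T-J.F₁ (f , T-J.F₁ (g , h))) ∘ inj U s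
        ≈ (T-J.F₁ (T-J.F₁ (f , g) , h) ∘ α⁻¹ (X , Y , Z)) ∘ inj U s
      α⁻¹-natural-inj {X} {X′} {Y} {Y′} {Z} {Z′} f g h U s = begin
        (α⁻¹ (X′ , Y′ , Z′) ∘ T-J.F₁ (f , T-J.F₁ (g , h))) ∘ inj U s
          ≈⟨ assoc ⟩
        α⁻¹ (X′ , Y′ , Z′) ∘ T-J.F₁ (f , T-J.F₁ (g , h)) ∘ inj U s
          ≈⟨ ∘-resp-≈ʳ (J-extension-inj f (T-J.F₁ (g , h)) U s) ⟩
        α⁻¹ (X′ , Y′ , Z′) ∘ inj U (f ∘ s) ∘ T.F₁ (V.id , T-J.F₁ (g , h))
          ≈⟨ Equiv.sym assoc ⟩
        (α⁻¹ (X′ , Y′ , Z′) ∘ inj U (f ∘ s)) ∘ T.F₁ (V.id , T-J.F₁ (g , h))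
          ≈⟨ ∘-resp-≈ˡ (α⁻¹-inj X′ Y′ Z′ U (f ∘ s)) ⟩
        (T-J.F₁ (inj U (f ∘ s) , id) ∘ 𝐚⁻¹.η (U , Y′ , Z′)) ∘ T.F₁ (V.id , T-J.F₁ (g , h))
          ≈⟨ assoc ⟩
        T-J.F₁ (inj U (f ∘ s) , id) ∘ 𝐚⁻¹.η (U , Y′ , Z′) ∘ T.F₁ (V.id , T-J.F₁ (g , h))
          -- On a summand `f` only changes the index, so `𝐚` is needed only at a fixed object of 𝓥.
          ≈⟨ ∘-resp-≈ʳ (𝐚⁻¹.commute (V.id , g , h)) ⟩
        T-J.F₁ (inj U (f ∘ s) , id) ∘ T-J.F₁ (T.F₁ (V.id , g) , h) ∘ 𝐚⁻¹.η (U , Y , Z)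
          ≈⟨ Equiv.sym assoc ⟩
        (T-J.F₁ (inj U (f ∘ s) , id) ∘ T-J.F₁ (T.F₁ (V.id , g) , h)) ∘ 𝐚⁻¹.η (U , Y , Z)
          ≈⟨ ∘-resp-≈ˡ (Equiv.sym T-J.homomorphism) ⟩
        T-J.F₁ (inj U (f ∘ s) ∘ T.F₁ (V.id , g) , id ∘ h) ∘ 𝐚⁻¹.η (U , Y , Z)
          -- The action of the inner `T-J` on the summand at `s`, read backwards, reassembles `f`
          -- and `g`.
          ≈⟨ ∘-resp-≈ˡ (T-J.F-resp-≈ (Equiv.sym (J-extension-inj f g U s)
                                     , Equiv.trans identityˡ (Equiv.sym identityʳ))) ⟩
        T-J.F₁ (T-J.F₁ (f , g) ∘ inj U s , h ∘ id) ∘ 𝐚⁻¹.η (U , Y , Z)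
          ≈⟨ ∘-resp-≈ˡ T-J.homomorphism ⟩
        (T-J.F₁ (T-J.F₁ (f , g) , h) ∘ T-J.F₁ (inj U s , id)) ∘ 𝐚⁻¹.η (U , Y , Z)
          ≈⟨ assoc ⟩
        T-J.F₁ (T-J.F₁ (f , g) , h) ∘ T-J.F₁ (inj U s , id) ∘ 𝐚⁻¹.η (U , Y , Z)
          ≈⟨ ∘-resp-≈ʳ (Equiv.sym (α⁻¹-inj X Y Z U s)) ⟩
        T-J.F₁ (T-J.F₁ (f , g) , h) ∘ α⁻¹ (X , Y , Z) ∘ inj U s
          ≈⟨ Equiv.sym assoc ⟩
        (T-J.F₁ (T-J.F₁ (f , g) , h) ∘ α⁻¹ (X , Y , Z)) ∘ inj U s  ∎

    J-extension-associator :
      let X = π₁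
          Y = π₁ ∘F π₂
          Z = π₂ ∘F π₂
      in _≅_ {C = A ⊠ A ⊠ A}
           (T-J ∘F ⟨ T-J ∘F ⟨ X , Y ⟩ , Z ⟩)
           (T-J ∘F ⟨ X , T-J ∘F ⟨ Y , Z ⟩ ⟩)
    J-extension-associator = ≅-sym (record
      { to    = record
        { η       = α⁻¹
        ; commute = λ (f , g , h) → inj-ext (α⁻¹-natural-inj f g h)
        }
      -- Invertibility comes from the factorisation: preservation gives the first factor, `𝐚` the
      -- second.
      ; isIso = λ (X , Y , Z) → IsIso-∘ (comparison-isIso X Y Z) (transfer-isIso X Y Z)
      })

-- The unit isomorphisms.

module _ {V : Category ℓ ℓ} {A : Category o ℓ} (cocomplete : Cocomplete A)
         (T : Functor (V ⊠ A) A) (J-I : Category.Obj A) where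
  private
    J = T ⟨–, J-I ⟩
    T-J = J-extension cocomplete J T
    module V = Category V
    module T = Functor T
    module T-J = Functor T-J
  open Category A
  open KanExtension cocomplete J
  open HomReasoning

  J-extension-unitorˡ : FullyFaithful J → (I : V.Obj) → (T ∘F ⟨ constF I , idF ⟩) ≅ idF →
                        (T-J ∘F ⟨ constF (Functor.F₀ J I) , idF ⟩) ≅ idF
  J-extension-unitorˡ J-ff I υ = record
    { to    = record { η = λ X → υ.η X ∘ γ.η (I , X) ; commute = natural }
    ; isIso = λ X → IsIso-∘ (υ.isIso X) (γ.isIso (I , X))
    }
    where
    module γ = _≅_ (J-extension-along cocomplete J T J-ff)
    module υ = _≅_ υ
    natural : ∀ {X Y} (g : X ⇒ Y) →
              (υ.η Y ∘ γ.η (I , Y)) ∘ T-J.F₁ (id , g) ≈ g ∘ υ.η X ∘ γ.η (I , X)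
    natural {X} {Y} g = begin
      (υ.η Y ∘ γ.η (I , Y)) ∘ T-J.F₁ (id , g)
        ≈⟨ assoc ⟩
      υ.η Y ∘ γ.η (I , Y) ∘ T-J.F₁ (id , g)
        -- The constant functor contributes `id`, whereas naturality of `γ` expects J of an
        -- identity.
        ≈⟨ ∘-resp-≈ʳ (∘-resp-≈ʳ (T-J.F-resp-≈ (Equiv.sym (Functor.identity J) , Equiv.refl))) ⟩
      υ.η Y ∘ γ.η (I , Y) ∘ T-J.F₁ (Functor.F₁ J V.id , g)
        ≈⟨ ∘-resp-≈ʳ (γ.commute (V.id , g)) ⟩
      υ.η Y ∘ T.F₁ (V.id , g) ∘ γ.η (I , X)
        ≈⟨ Equiv.sym assoc ⟩
      (υ.η Y ∘ T.F₁ (V.id , g)) ∘ γ.η (I , X)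
        ≈⟨ ∘-resp-≈ˡ (υ.commute g) ⟩
      (g ∘ υ.η X) ∘ γ.η (I , X)
        ≈⟨ assoc ⟩
      g ∘ υ.η X ∘ γ.η (I , X)  ∎

  -- Since J is `T ⟨–, J-I ⟩`, the value of `T-J` at `X , J-I` is literally Lan_J J at X, which
  -- density identifies with X. The isomorphism `k` moves the second argument to `J-I` first.
  J-extension-unitorʳ : Dense J → ∀ {JI} {k : JI ⇒ J-I} → IsIso k →
                        (T-J ∘F ⟨ idF , constF JI ⟩) ≅ idF
  J-extension-unitorʳ dense {JI} {k} k-isIso = record
    { to    = record { η = λ X → ε X ∘ T-J.F₁ (id , k) ; commute = natural }
    ; isIso = λ X → IsIso-∘ (Dense⇒Lan-counit-IsIso cocomplete J dense X)
                            (Functor-IsIso T-J (⊠-IsIso {C = A} {D = A} IsIso-id k-isIso))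
    }
    where
    ε : ∀ X → T-J.F₀ (X , J-I) ⇒ X
    ε = Lan-counit cocomplete J

    ε-inj : ∀ {X} U (s : Functor.F₀ J U ⇒ X) → ε X ∘ inj U s ≈ s
    ε-inj = Lan-counit-inj cocomplete J

    ε-natural : ∀ {X Y} (f : X ⇒ Y) → ε Y ∘ T-J.F₁ (f , id) ≈ f ∘ ε X
    ε-natural {X} {Y} f = inj-ext λ U s → begin
      (ε Y ∘ T-J.F₁ (f , id)) ∘ inj U s        ≈⟨ assoc ⟩
      ε Y ∘ T-J.F₁ (f , id) ∘ inj U s          ≈⟨ ∘-resp-≈ʳ (J-extension-inj cocomplete J T f id U s) ⟩
      ε Y ∘ inj U (f ∘ s) ∘ T.F₁ (V.id , id)   ≈⟨ ∘-resp-≈ʳ (Equiv.trans (∘-resp-≈ʳ T.identity) identityʳ) ⟩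
      ε Y ∘ inj U (f ∘ s)                      ≈⟨ ε-inj U (f ∘ s) ⟩
      f ∘ s                                    ≈⟨ ∘-resp-≈ʳ (Equiv.sym (ε-inj U s)) ⟩
      f ∘ ε X ∘ inj U s                        ≈⟨ Equiv.sym assoc ⟩
      (f ∘ ε X) ∘ inj U s                      ∎

    natural : ∀ {X Y} (f : X ⇒ Y) →
              (ε Y ∘ T-J.F₁ (id , k)) ∘ T-J.F₁ (f , id) ≈ f ∘ ε X ∘ T-J.F₁ (id , k)
    natural {X} {Y} f = begin
      (ε Y ∘ T-J.F₁ (id , k)) ∘ T-J.F₁ (f , id)  ≈⟨ assoc ⟩
      ε Y ∘ T-J.F₁ (id , k) ∘ T-J.F₁ (f , id)    ≈⟨ ∘-resp-≈ʳ (Equiv.sym T-J.homomorphism) ⟩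
      ε Y ∘ T-J.F₁ (id ∘ f , k ∘ id)             ≈⟨ ∘-resp-≈ʳ (T-J.F-resp-≈
                                                      ( Equiv.trans identityˡ (Equiv.sym identityʳ)
                                                      , Equiv.trans identityʳ (Equiv.sym identityˡ))) ⟩
      ε Y ∘ T-J.F₁ (f ∘ id , id ∘ k)             ≈⟨ ∘-resp-≈ʳ T-J.homomorphism ⟩
      ε Y ∘ T-J.F₁ (f , id) ∘ T-J.F₁ (id , k)    ≈⟨ Equiv.sym assoc ⟩
      (ε Y ∘ T-J.F₁ (f , id)) ∘ T-J.F₁ (id , k)  ≈⟨ ∘-resp-≈ˡ (ε-natural f) ⟩
      (f ∘ ε X) ∘ T-J.F₁ (id , k)                ≈⟨ assoc ⟩
      f ∘ ε X ∘ T-J.F₁ (id , k)                  ∎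

theorem4p8 :
  ∀ {o ℓ : Level} {A : Category o ℓ} (cocomplete : Cocomplete A)
    {V : Category ℓ ℓ} (M : Monoidal V) (act : Action M A)
    (J-I : Category.Obj A) →
  let open Action act using (◁)
      J = ◁ ⟨–, J-I ⟩
      JI = Functor.F₀ J (Monoidal.unit M)
      ◁J = J-extension cocomplete J ◁
  in
  (∀ X → WellBehaved cocomplete J (◁ ⟨–, X ⟩)) →
  (let U = π₁
       X = π₁ ∘F π₂
       Y = π₂ ∘F π₂
   in _≅_ {C = V ⊠ A ⊠ A}
        (◁J ∘F ⟨ ◁ ∘F ⟨ U , X ⟩ , Y ⟩)
        (◁ ∘F ⟨ U , ◁J ∘F ⟨ X , Y ⟩ ⟩)) →
  (let X = π₁
       Y = π₁ ∘F π₂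
       Z = π₂ ∘F π₂
   in _≅_ {C = A ⊠ A ⊠ A}
        (◁J ∘F ⟨ ◁J ∘F ⟨ X , Y ⟩ , Z ⟩)
        (◁J ∘F ⟨ X , ◁J ∘F ⟨ Y , Z ⟩ ⟩))
  × (◁J ∘F ⟨ constF JI , idF ⟩) ≅ idF
  × (◁J ∘F ⟨ idF , constF JI ⟩) ≅ idF
  × (◁J ∘F ⟨ J ∘F π₁ , π₂ ⟩) ≅ ◁
theorem4p8 cocomplete M act J-I well-behaved 𝐚 =
    J-extension-associator cocomplete J ◁ (λ Y → preserves (well-behaved Y)) 𝐚
  , J-extension-unitorˡ cocomplete ◁ J-I (fullyFaithful (well-behaved J-I)) (Monoidal.unit M) actUnit
  -- Here `k` is the unit isomorphism I ◁ J_I ≅ J_I of the action.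
  , J-extension-unitorʳ cocomplete ◁ J-I (dense (well-behaved J-I)) (_≅_.isIso actUnit J-I)
  , J-extension-along cocomplete J ◁ (fullyFaithful (well-behaved J-I))
  where
  open Action act
  open WellBehaved
  J = ◁ ⟨–, J-I ⟩
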